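{- Let $q$ be a prime power and $m,n$ positive integers with $\max\{m,n\}>1$. Suppose $f(X)\in\mathbb{F}_q[X]$ is $(m,n)$-decomposable and irreducible in $\mathbb{F}_q[X]$. Then $f(X)$ is uniquely $(m,n)$-decomposable.
   Context: An $(m,n)$-decomposition of $f(X)\in\mathbb{F}_q[X]$ is an expression $f(X)=g(X)^m h\!\left(X^n/g(X)\right)$ where $h(X)\in\mathbb{F}_q[X]$ is monic of degree $m$ with $h(0)\ne 0$ and $g(X)\in\mathbb{F}_q[X]$ (not necessarily monic) has degree at most $n-1$ with $g(0)=1$. $f$ is $(m,n)$-decomposable if it admits such a decomposition, and uniquely $(m,n)$-decomposable if the pair $(g,h)$ in such a decomposition is unique. -}

module Defs where

open import Level using (Level; _⊔_) renaming (suc to lsuc)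
open import Data.Nat as ℕ using (ℕ; zero; suc; _∸_; _<_; _≤_)
open import Data.Nat.Primality using (Prime)
open import Data.Fin using (Fin)
open import Data.List using (List; []; _∷_; map; replicate; _++_; foldr; applyUpTo)
open import Data.Product using (Σ; ∃; _×_; _,_)
open import Data.Sum using (_⊎_)
open import Relation.Nullary using (¬_)
open import Relation.Binary using (Decidable)
open import Relation.Binary.PropositionalEquality as ≡ using (_≡_)
open import Function.Bundles using (Bijection)
open import Algebra.Bundles using (CommutativeRing)

IsPrimePower : ℕ → Set
IsPrimePower q = Σ ℕ λ p → Σ ℕ λ k → Prime p × (1 ≤ k) × (q ≡ p ℕ.^ k)

record IsFiniteField {c ℓ} (R : CommutativeRing c ℓ) (q : ℕ) : Set (c ⊔ ℓ) where
  open CommutativeRing R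
  field
    0≉1      : ¬ (0# ≈ 1#)
    inverse  : ∀ x → ¬ (x ≈ 0#) → Σ Carrier λ y → x * y ≈ 1#
    _≟_      : Decidable _≈_
    card     : Bijection (≡.setoid (Fin q)) setoid

-- Polynomials in one variable X over a commutative ring R, represented by
-- lists of coefficients, lowest degree first. Two polynomials are equal
-- iff all their coefficients agree (so trailing zeros are irrelevant).
module Poly {c ℓ} (R : CommutativeRing c ℓ) where
  open CommutativeRing R

  Polynomial : Set c
  Polynomial = List Carrier

  coeff : Polynomial → ℕ → Carrier
  coeff []       _       = 0#
  coeff (a ∷ p)  zero    = a
  coeff (a ∷ p)  (suc i) = coeff p i

  infix 4 _≈ₚ_
  _≈ₚ_ : Polynomial → Polynomial → Set ℓ
  p ≈ₚ r = ∀ i → coeff p i ≈ coeff r i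

  infixl 6 _+ₚ_
  _+ₚ_ : Polynomial → Polynomial → Polynomial
  []      +ₚ r       = r
  (a ∷ p) +ₚ []      = a ∷ p
  (a ∷ p) +ₚ (b ∷ r) = (a + b) ∷ (p +ₚ r)

  constP : Carrier → Polynomial
  constP a = a ∷ []

  zeroP : Polynomial
  zeroP = []

  oneP : Polynomial
  oneP = constP 1#

  infixl 7 _*ₚ_
  _*ₚ_ : Polynomial → Polynomial → Polynomial
  []      *ₚ r = []
  (a ∷ p) *ₚ r = map (a *_) r +ₚ (0# ∷ (p *ₚ r))

  X^ : ℕ → Polynomial
  X^ k = replicate k 0# ++ (1# ∷ [])

  _^ₚ_ : Polynomial → ℕ → Polynomial
  p ^ₚ zero  = oneP
  p ^ₚ suc k = p *ₚ (p ^ₚ k)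

  sumP : List Polynomial → Polynomial
  sumP = foldr _+ₚ_ zeroP

  DegreeAtMost : ℕ → Polynomial → Set ℓ
  DegreeAtMost d p = ∀ i → d < i → coeff p i ≈ 0#

  MonicOfDegree : ℕ → Polynomial → Set ℓ
  MonicOfDegree d p = (coeff p d ≈ 1#) × DegreeAtMost d p

  IsUnit : Polynomial → Set (c ⊔ ℓ)
  IsUnit p = Σ Polynomial λ u → p *ₚ u ≈ₚ oneP

  Irreducible : Polynomial → Set (c ⊔ ℓ)
  Irreducible f = ¬ (f ≈ₚ zeroP) × ¬ IsUnit f
                × (∀ a b → f ≈ₚ a *ₚ b → IsUnit a ⊎ IsUnit b)

  -- g(X)^m h(X^n / g(X)) = Σ_{i=0}^{m} h_i X^{n i} g(X)^{m-i}, where deg h = m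
  compose : ℕ → ℕ → Polynomial → Polynomial → Polynomial
  compose m n g h =
    sumP (applyUpTo (λ i → constP (coeff h i) *ₚ (X^ (n ℕ.* i) *ₚ (g ^ₚ (m ∸ i)))) (suc m))

  IsDecomposition : ℕ → ℕ → Polynomial → Polynomial → Polynomial → Set ℓ
  IsDecomposition m n f g h =
    MonicOfDegree m h × ¬ (coeff h 0 ≈ 0#)
    × DegreeAtMost (n ∸ 1) g × (coeff g 0 ≈ 1#)
    × (f ≈ₚ compose m n g h)

  Decomposable : ℕ → ℕ → Polynomial → Set (c ⊔ ℓ)
  Decomposable m n f = Σ Polynomial λ g → Σ Polynomial λ h → IsDecomposition m n f g h

  UniquelyDecomposable : ℕ → ℕ → Polynomial → Set (c ⊔ ℓ)
  UniquelyDecomposable m n f =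
    Decomposable m n f
    × (∀ g h g′ h′ → IsDecomposition m n f g h → IsDecomposition m n f g′ h′
                   → (g ≈ₚ g′) × (h ≈ₚ h′))

{-# OPTIONS --safe #-}
module Submission where

open import Defs
open import Level using (Level)
open import Data.Nat as ℕ using (ℕ; zero; suc; _∸_; _<_; _≤_; _⊔_; z≤n; s≤s; z<s; s<s)
import Data.Nat.Properties as ℕₚ
open import Data.Fin as Fin using (Fin; zero; suc; punchIn; punchOut)
import Data.Fin.Properties as Finₚ
open import Data.Fin.Permutation using (Permutation; permutation)
open import Data.List using ([]; _∷_; map; applyUpTo)
open import Data.Product using (∃; ∃₂; _×_; _,_; proj₁; proj₂; uncurry)
open import Data.Sum using (_⊎_; inj₁; inj₂)
open import Data.Vec.Functional using (Vector)
open import Function using (_∘_; Injective)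
open import Function.Bundles using (Bijection)
open import Relation.Nullary using (¬_; yes; no; contradiction)
open import Relation.Binary.Definitions using (Tri; tri<; tri≈; tri>)
open import Relation.Binary.PropositionalEquality as ≡ using (_≡_; _≢_)
open import Algebra.Bundles using (CommutativeRing)
open import Algebra.Morphism.Structures using (IsRingHomomorphism)

-- In the field K = F[X]/(f) let β be the class of Xⁿ/g. Then h(β) = 0, and the mn elements
-- βⁱ Xʲ (i < m, j < n) are linearly independent over F, because g(0) = 1 makes the polynomials
-- X^{ni+j} g^{m−1−i} triangular and their degrees are below mn = deg f. Hence F(β) has q^m
-- elements; its nonzero elements are all the roots of T^{q^m − 1} − 1 in K, so a second
-- decomposition (g′, h′) yields β′ ∈ F(β). Comparing coefficients of X⁰ over F(β) in
-- β g(X) = Xⁿ = β′ g′(X) gives β = β′, whence g = g′; and h = h′ since both are the minimal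
-- polynomial of β.

-- Two decompositions give elements β and β′ of K with no visible relation. Finiteness supplies one:
-- N distinct nonzero elements of a domain that are closed under multiplication are exactly the
-- roots of T^N - 1, so N alone determines the set. The condition h′(0) ≠ 0 keeps β′ away from 0 and
-- so among such roots; the same condition on h later allows β to be cancelled. The comparison over
-- F(β) avoids linear algebra over that field. An expression in the βⁱ Xʲ is kept as Σ Cᵢ βⁱ with
-- polynomials Cᵢ of degree below n, and multiplication by g^(m-1) turns it into a genuine
-- polynomial of degree below mn. If it vanishes in K it vanishes in F[X], and the Cᵢ can be read
-- off. That deg f = mn is itself a consequence of deg g ≤ n - 1: only the last term of g^m h(Xⁿ/g)
-- reaches that degree.

-- Injective self-maps of finite sets.

-- A missed value could be punched out of the codomain, leaving an injection from `Fin (suc n)` into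
-- `Fin n`.
injective⇒surjective : ∀ {n} {σ : Fin n → Fin n} → Injective _≡_ _≡_ σ → ∀ i → ∃ λ j → σ j ≡ i
injective⇒surjective {suc n} {σ} inj i with Finₚ.any? (λ j → σ j Fin.≟ i)
... | yes hit = hit
... | no miss = contradiction (Finₚ.injective⇒≤ avoid-injective) ℕₚ.1+n≰n
  where
  i≢σ : ∀ j → i ≢ σ j
  i≢σ j i≡σj = miss (j , ≡.sym i≡σj)
  avoid : Fin (suc n) → Fin n
  avoid j = punchOut (i≢σ j)
  avoid-injective : Injective _≡_ _≡_ avoid
  avoid-injective {j} {k} eq = inj (Finₚ.punchOut-injective (i≢σ j) (i≢σ k) eq)

injective⇒permutation : ∀ {n} {σ : Fin n → Fin n} → Injective _≡_ _≡_ σ → Permutation n n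
injective⇒permutation {n} {σ} inj = permutation σ τ σ∘τ (λ j → inj (σ∘τ (σ j)))
  where
  τ : Fin n → Fin n
  τ i = proj₁ (injective⇒surjective inj i)
  σ∘τ : ∀ i → σ (τ i) ≡ i
  σ∘τ i = proj₂ (injective⇒surjective inj i)

-- Roots of polynomials and finite multiplicative sets in a domain.

module RingExtras {c ℓ} (R : CommutativeRing c ℓ) where
  open CommutativeRing R public hiding (zero)
  open import Algebra.Properties.Ring ring public
  open import Algebra.Properties.CommutativeSemiring.Exp commutativeSemiring public
  open import Algebra.Solver.Ring.NaturalCoefficients.Default commutativeSemiring public
    using (solve; _:=_; _:+_; _:*_)
  open import Relation.Binary.Reasoning.Setoid setoid public

  ≈⇒-≈0 : ∀ {x y} → x ≈ y → x - y ≈ 0#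
  ≈⇒-≈0 {x} {y} eq = trans (+-congʳ eq) (-‿inverseʳ y)

  -≈0⇒≈ : ∀ {x y} → x - y ≈ 0# → x ≈ y
  -≈0⇒≈ {x} {y} = x∙y⁻¹≈ε⇒x≈y x y

record IsDomain {c ℓ} (R : CommutativeRing c ℓ) : Set (c Level.⊔ ℓ) where
  open CommutativeRing R
  field
    1≉0            : ¬ 1# ≈ 0#
    noZeroDivisors : ∀ x y → x * y ≈ 0# → x ≈ 0# ⊎ y ≈ 0#

module DomainProperties {c ℓ} {R : CommutativeRing c ℓ} (isDomain : IsDomain R) where
  open RingExtras R
  open IsDomain isDomain public
  open import Algebra.Properties.CommutativeMonoid.Sum *-commutativeMonoid
    using () renaming (sum to ∏; sum-permute to ∏-permute; sum-cong-≋ to ∏-cong)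

  *-cancelˡ : ∀ a {x y} → a * x ≈ a * y → ¬ a ≈ 0# → x ≈ y
  *-cancelˡ a {x} {y} ax≈ay a≉0
    with noZeroDivisors a (x - y) (trans (x[y-z]≈xy-xz a x y) (≈⇒-≈0 ax≈ay))
  ... | inj₁ a≈0   = contradiction a≈0 a≉0
  ... | inj₂ x-y≈0 = -≈0⇒≈ x-y≈0

  x≉0∧xy≈0⇒y≈0 : ∀ x {y} → ¬ x ≈ 0# → x * y ≈ 0# → y ≈ 0#
  x≉0∧xy≈0⇒y≈0 x {y} x≉0 xy≈0 = *-cancelˡ x (trans xy≈0 (sym (zeroʳ x))) x≉0

  *-≉0 : ∀ {x y} → ¬ x ≈ 0# → ¬ y ≈ 0# → ¬ x * y ≈ 0#
  *-≉0 {x} {y} x≉0 y≉0 xy≈0 with noZeroDivisors x y xy≈0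
  ... | inj₁ x≈0 = x≉0 x≈0
  ... | inj₂ y≈0 = y≉0 y≈0

  -- Monic polynomials as functions, built in Horner style from the leading 1 outwards. The index is
  -- the exact degree, and functions such as x ↦ xⁿ - 1 qualify directly, without an evaluation map.
  data Monic : ℕ → (Carrier → Carrier) → Set (c Level.⊔ ℓ) where
    one  : ∀ {P} → (∀ x → P x ≈ 1#) → Monic 0 P
    step : ∀ {d P Q} a → Monic d Q → (∀ x → P x ≈ x * Q x + a) → Monic (suc d) P

  -- P x − P r = (x − r) Q x, with both sides moved so that no subtraction occurs.
  factor : ∀ {d P} → Monic (suc d) P → ∀ r →
           ∃ λ Q → Monic d Q × (∀ x → P x + r * Q x ≈ x * Q x + P r)
  factor {P = P} (step {Q = P′} a (one P′≈1) P≈) r = (λ _ → 1#) , one (λ _ → refl) , λ x → begin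
    P x + r * 1#           ≈⟨ +-congʳ (P≈ x) ⟩
    (x * P′ x + a) + r * 1#  ≈⟨ +-congʳ (+-congʳ (*-congˡ (P′≈1 x))) ⟩
    (x * 1# + a) + r * 1#    ≈⟨ solve 3 (λ p q s → (p :+ q) :+ s := p :+ (s :+ q)) refl (x * 1#) a (r * 1#) ⟩
    x * 1# + (r * 1# + a)    ≈⟨ +-congˡ (+-congʳ (*-congˡ (P′≈1 r))) ⟨
    x * 1# + (r * P′ r + a)  ≈⟨ +-congˡ (P≈ r) ⟨
    x * 1# + P r             ∎
  factor {P = P} (step {Q = P′} a mP′@(step _ _ _) P≈) r with factor mP′ r
  -- The new quotient comes from P(x) - P(r) = x (P′(x) - P′(r)) + (x - r) P′(r), where P′ is the
  -- tail of P and not a derivative.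
  ... | Q′ , mQ′ , eq = (λ x → x * Q′ x + P′ r) , step (P′ r) mQ′ (λ _ → refl) , λ x → begin
    P x + r * (x * Q′ x + P′ r)               ≈⟨ +-congʳ (P≈ x) ⟩
    (x * P′ x + a) + r * (x * Q′ x + P′ r)
      ≈⟨ solve 6 (λ x p a r q p′ → (x :* p :+ a) :+ r :* (x :* q :+ p′) := x :* (p :+ r :* q) :+ (r :* p′ :+ a))
               refl x (P′ x) a r (Q′ x) (P′ r) ⟩
    x * (P′ x + r * Q′ x) + (r * P′ r + a)    ≈⟨ +-cong (*-congˡ (eq x)) (sym (P≈ r)) ⟩
    x * (x * Q′ x + P′ r) + P r               ∎

  -- Splitting off the factor at `ρ zero` leaves a quotient of degree d - 1. In a domain every root
  -- other than `ρ zero` must be a root of that quotient, so the remaining d - 1 known roots serve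
  -- the induction.
  root-among : ∀ {d P} → Monic d P → (ρ : Fin d → Carrier) → Injective _≡_ _≈_ ρ →
               (∀ i → P (ρ i) ≈ 0#) → ∀ y → P y ≈ 0# → ∃ λ i → y ≈ ρ i
  root-among {zero} (one P≈1) _ _ _ y Py≈0 = contradiction (trans (sym (P≈1 y)) Py≈0) 1≉0
  root-among {suc d} {P} mP ρ inj roots y Py≈0 with factor mP (ρ zero)
  ... | Q , mQ , eq = conclude (split y Py≈0)
    where
    split : ∀ z → P z ≈ 0# → z ≈ ρ zero ⊎ Q z ≈ 0#
    split z Pz≈0 with noZeroDivisors (Q z) (z - ρ zero) (trans (x[y-z]≈xy-xz _ _ _) (≈⇒-≈0 (begin
      Q z * z                ≈⟨ *-comm _ _ ⟩
      z * Q z                ≈⟨ +-identityʳ _ ⟨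
      z * Q z + 0#           ≈⟨ +-congˡ (roots zero) ⟨
      z * Q z + P (ρ zero)   ≈⟨ eq z ⟨
      P z + ρ zero * Q z     ≈⟨ +-congʳ Pz≈0 ⟩
      0# + ρ zero * Q z      ≈⟨ +-identityˡ _ ⟩
      ρ zero * Q z           ≈⟨ *-comm _ _ ⟩
      Q z * ρ zero           ∎)))
    ... | inj₁ Qz≈0  = inj₂ Qz≈0
    ... | inj₂ z-r≈0 = inj₁ (-≈0⇒≈ z-r≈0)

    rest : ∀ i → Q (ρ (suc i)) ≈ 0#
    rest i with split (ρ (suc i)) (roots (suc i))
    ... | inj₁ same = contradiction (inj same) λ ()
    ... | inj₂ Q≈0  = Q≈0

    conclude : y ≈ ρ zero ⊎ Q y ≈ 0# → ∃ λ i → y ≈ ρ i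
    conclude (inj₁ y≈r) = zero , y≈r
    conclude (inj₂ Qy≈0) with root-among mQ (ρ ∘ suc) (Finₚ.suc-injective ∘ inj) rest y Qy≈0
    ... | i , y≈ = suc i , y≈

  power-minus-one : ∀ n → Monic (suc n) (λ x → x ^ suc n - 1#)
  power-minus-one n = step (- 1#) (power n) (λ _ → refl)
    where
    power : ∀ n → Monic n (_^ n)
    power zero    = one (λ _ → refl)
    power (suc n) = step 0# (power n) (λ x → sym (+-identityʳ _))

  -- Modelled on the nonzero elements of a finite subfield, listed without repetition. Closure
  -- together with cancellation in the domain makes multiplication by any member a permutation of
  -- the list.
  record FiniteSubmagma (N : ℕ) : Set (c Level.⊔ ℓ) where
    field
      elem      : Fin N → Carrier
      injective : Injective _≡_ _≈_ elem
      nonzero   : ∀ i → ¬ elem i ≈ 0#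
      closed    : ∀ i j → ∃ λ k → elem i * elem j ≈ elem k

  -- Multiplication by y permutes the elements, so their product P satisfies P = yᴺ P.
  elem^N≈1 : ∀ {N} (M : FiniteSubmagma N) i → FiniteSubmagma.elem M i ^ N ≈ 1#
  elem^N≈1 {N} M i = *-cancelˡ (∏ elem) (begin
    ∏ elem * elem i ^ N           ≈⟨ *-comm _ _ ⟩
    elem i ^ N * ∏ elem           ≈⟨ ∏-scale elem ⟨
    ∏ (λ j → elem i * elem j)     ≈⟨ ∏-cong (λ j → proj₂ (closed i j)) ⟩
    ∏ (elem ∘ σ)                  ≈⟨ ∏-permute elem (injective⇒permutation σ-injective) ⟨
    ∏ elem                        ≈⟨ *-identityʳ _ ⟨
    ∏ elem * 1#                   ∎) (∏-≉0 elem nonzero)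
    where
    open FiniteSubmagma M

    σ : Fin N → Fin N
    σ j = proj₁ (closed i j)

    σ-injective : Injective _≡_ _≡_ σ
    σ-injective {j} {k} eq = injective (*-cancelˡ (elem i) (begin
      elem i * elem j  ≈⟨ proj₂ (closed i j) ⟩
      elem (σ j)       ≡⟨ ≡.cong elem eq ⟩
      elem (σ k)       ≈⟨ proj₂ (closed i k) ⟨
      elem i * elem k  ∎) (nonzero i))

    ∏-scale : ∀ {n} (t : Vector Carrier n) → ∏ (λ j → elem i * t j) ≈ elem i ^ n * ∏ t
    ∏-scale {zero}  t = sym (*-identityʳ _)
    ∏-scale {suc n} t = begin
      elem i * t zero * ∏ (λ j → elem i * t (suc j)) ≈⟨ *-congˡ (∏-scale (t ∘ suc)) ⟩
      elem i * t zero * (elem i ^ n * ∏ (t ∘ suc))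
        ≈⟨ solve 4 (λ e a p b → e :* a :* (p :* b) := e :* p :* (a :* b))
                 refl (elem i) (t zero) (elem i ^ n) (∏ (t ∘ suc)) ⟩
      elem i * elem i ^ n * (t zero * ∏ (t ∘ suc))  ∎

    ∏-≉0 : ∀ {n} (t : Vector Carrier n) → (∀ j → ¬ t j ≈ 0#) → ¬ ∏ t ≈ 0#
    ∏-≉0 {zero}  t _  = 1≉0
    ∏-≉0 {suc n} t t≉0 = *-≉0 (t≉0 zero) (∏-≉0 (t ∘ suc) (t≉0 ∘ suc))

  -- Both consist of the N-th roots of unity.
  equipotent⇒⊆ : ∀ {N} (M M′ : FiniteSubmagma N) i →
                 ∃ λ j → FiniteSubmagma.elem M′ i ≈ FiniteSubmagma.elem M j
  equipotent⇒⊆ {suc N} M M′ i =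
    root-among (power-minus-one N) elem injective (λ j → ≈⇒-≈0 (elem^N≈1 M j))
               _ (≈⇒-≈0 (elem^N≈1 M′ i))
    where open FiniteSubmagma M

-- Evaluation of polynomials by Horner's rule.

module Horner {c ℓ} (R : CommutativeRing c ℓ) where
  open RingExtras R

  -- This is Σ_{i<m} aᵢ xⁱ. The first argument counts terms, so a polynomial of degree m is
  -- evaluated with `suc m`.
  horner : ℕ → Carrier → (ℕ → Carrier) → Carrier
  horner zero    x a = 0#
  horner (suc m) x a = a 0 + x * horner m x (a ∘ suc)

  horner-cong : ∀ m {x y a b} → x ≈ y → (∀ i → i < m → a i ≈ b i) → horner m x a ≈ horner m y b
  horner-cong zero    x≈y a≈b = refl
  horner-cong (suc m) x≈y a≈b =
    +-cong (a≈b 0 z<s) (*-cong x≈y (horner-cong m x≈y (λ i i<m → a≈b (suc i) (s<s i<m))))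

  horner-congʳ : ∀ m {x a b} → (∀ i → a i ≈ b i) → horner m x a ≈ horner m x b
  horner-congʳ m a≈b = horner-cong m refl (λ i _ → a≈b i)

  horner-0 : ∀ m x → horner m x (λ _ → 0#) ≈ 0#
  horner-0 zero    x = refl
  horner-0 (suc m) x = trans (+-identityˡ _) (trans (*-congˡ (horner-0 m x)) (zeroʳ x))

  horner-+ : ∀ m x a b → horner m x (λ i → a i + b i) ≈ horner m x a + horner m x b
  horner-+ zero    x a b = sym (+-identityˡ 0#)
  horner-+ (suc m) x a b = begin
    (a 0 + b 0) + x * horner m x (λ i → a (suc i) + b (suc i))
      ≈⟨ +-congˡ (*-congˡ (horner-+ m x (a ∘ suc) (b ∘ suc))) ⟩
    (a 0 + b 0) + x * (horner m x (a ∘ suc) + horner m x (b ∘ suc))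
      ≈⟨ solve 5 (λ p q x s t → (p :+ q) :+ x :* (s :+ t) := (p :+ x :* s) :+ (q :+ x :* t)) refl
               (a 0) (b 0) x (horner m x (a ∘ suc)) (horner m x (b ∘ suc)) ⟩
    (a 0 + x * horner m x (a ∘ suc)) + (b 0 + x * horner m x (b ∘ suc)) ∎

  horner-*ˡ : ∀ m x k a → horner m x (λ i → k * a i) ≈ k * horner m x a
  horner-*ˡ zero    x k a = sym (zeroʳ k)
  horner-*ˡ (suc m) x k a = begin
    k * a 0 + x * horner m x (λ i → k * a (suc i))  ≈⟨ +-congˡ (*-congˡ (horner-*ˡ m x k (a ∘ suc))) ⟩
    k * a 0 + x * (k * horner m x (a ∘ suc))
      ≈⟨ solve 4 (λ k p x s → k :* p :+ x :* (k :* s) := k :* (p :+ x :* s)) refl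
               k (a 0) x (horner m x (a ∘ suc)) ⟩
    k * (a 0 + x * horner m x (a ∘ suc))            ∎

  horner-*ʳ : ∀ m x k a → horner m x (λ i → a i * k) ≈ horner m x a * k
  horner-*ʳ m x k a = begin
    horner m x (λ i → a i * k)  ≈⟨ horner-congʳ m (λ i → *-comm (a i) k) ⟩
    horner m x (λ i → k * a i)  ≈⟨ horner-*ˡ m x k a ⟩
    k * horner m x a            ≈⟨ *-comm _ _ ⟩
    horner m x a * k            ∎

  horner-neg : ∀ m x a → horner m x (λ i → - a i) ≈ - horner m x a
  horner-neg m x a = begin
    horner m x (λ i → - a i)       ≈⟨ horner-congʳ m (λ i → -1*x≈-x (a i)) ⟨
    horner m x (λ i → - 1# * a i)  ≈⟨ horner-*ˡ m x (- 1#) a ⟩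
    - 1# * horner m x a            ≈⟨ -1*x≈-x _ ⟩
    - horner m x a                 ∎

  horner-sub : ∀ m x a b → horner m x (λ i → a i - b i) ≈ horner m x a - horner m x b
  horner-sub m x a b = trans (horner-+ m x a (λ i → - b i)) (+-congˡ (horner-neg m x b))

  horner-last : ∀ m x a → horner (suc m) x a ≈ horner m x a + a m * x ^ m
  horner-last zero    x a = begin
    a 0 + x * 0#   ≈⟨ +-congˡ (zeroʳ x) ⟩
    a 0 + 0#       ≈⟨ +-comm _ _ ⟩
    0# + a 0       ≈⟨ +-congˡ (*-identityʳ _) ⟨
    0# + a 0 * 1#  ∎
  horner-last (suc m) x a = begin
    a 0 + x * horner (suc m) x (a ∘ suc)                    ≈⟨ +-congˡ (*-congˡ (horner-last m x (a ∘ suc))) ⟩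
    a 0 + x * (horner m x (a ∘ suc) + a (suc m) * x ^ m)
      ≈⟨ solve 5 (λ p x s q y → p :+ x :* (s :+ q :* y) := (p :+ x :* s) :+ q :* (x :* y)) refl
               (a 0) x (horner m x (a ∘ suc)) (a (suc m)) (x ^ m) ⟩
    (a 0 + x * horner m x (a ∘ suc)) + a (suc m) * (x * x ^ m) ∎

-- The F-span of the powers of β below β^m.

module Span {a ℓ₁ b ℓ₂} {F : CommutativeRing a ℓ₁} {R : CommutativeRing b ℓ₂}
  {ι : CommutativeRing.Carrier F → CommutativeRing.Carrier R}
  (isHom : IsRingHomomorphism (CommutativeRing.rawRing F) (CommutativeRing.rawRing R) ι)
  where
  private module F = CommutativeRing F
  open RingExtras R
  open Horner R
  open IsRingHomomorphism isHom using (⟦⟧-cong; +-homo; *-homo; 0#-homo; 1#-homo; -‿homo)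

  -- Coordinates are functions on all of ℕ, of which only the values below m matter; shifting them
  -- is then composition with `suc`.
  combination : ℕ → Carrier → (ℕ → F.Carrier) → Carrier
  combination m β a = horner m β (ι ∘ a)

  private
    prepend : F.Carrier → (ℕ → F.Carrier) → ℕ → F.Carrier
    prepend x a zero    = x
    prepend x a (suc i) = a i

  combination-0 : ∀ m β → combination m β (λ _ → F.0#) ≈ 0#
  combination-0 m β = trans (horner-congʳ m (λ _ → 0#-homo)) (horner-0 m β)

  combination-1 : ∀ m → 0 < m → ∀ β → combination m β (prepend F.1# (λ _ → F.0#)) ≈ 1#
  combination-1 (suc m) _ β = begin
    ι F.1# + β * combination m β (λ _ → F.0#)   ≈⟨ +-cong 1#-homo (*-congˡ (combination-0 m β)) ⟩
    1# + β * 0#                                 ≈⟨ +-congˡ (zeroʳ β) ⟩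
    1# + 0#                                     ≈⟨ +-identityʳ _ ⟩
    1#                                          ∎

  combination-at-0 : ∀ m → 0 < m → ∀ {β} → β ≈ 0# → ∀ a → combination m β a ≈ ι (a 0)
  combination-at-0 (suc m) _ {β} β≈0 a =
    trans (+-congˡ (trans (*-congʳ β≈0) (zeroˡ _))) (+-identityʳ _)

  module _ (m : ℕ) (β : Carrier) where

    record InSpan (y : Carrier) : Set (a Level.⊔ ℓ₂) where
      constructor inSpan
      field
        coordinates : ℕ → F.Carrier
        eq          : y ≈ combination m β coordinates

    -- The leading coefficient 1 is built in, so only the values of h below m are read.
    MonicRelation : (ℕ → F.Carrier) → Set ℓ₂
    MonicRelation h = combination m β h + β ^ m ≈ 0#

    monicRelation : ∀ h → h m F.≈ F.1# → combination (suc m) β h ≈ 0# → MonicRelation h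
    monicRelation h h_m≈1 hβ≈0 = begin
      combination m β h + β ^ m              ≈⟨ +-congˡ (*-identityˡ _) ⟨
      combination m β h + 1# * β ^ m         ≈⟨ +-congˡ (*-congʳ (trans (⟦⟧-cong h_m≈1) 1#-homo)) ⟨
      combination m β h + ι (h m) * β ^ m    ≈⟨ horner-last m β (ι ∘ h) ⟨
      combination (suc m) β h                ≈⟨ hβ≈0 ⟩
      0#                                     ∎

    span-resp-≈ : ∀ {y z} → y ≈ z → InSpan y → InSpan z
    span-resp-≈ y≈z (inSpan a y≈) = inSpan a (trans (sym y≈z) y≈)

    combination-+ : ∀ a b → combination m β a + combination m β b ≈ combination m β (λ i → a i F.+ b i)
    combination-+ a b = begin
      combination m β a + combination m β b    ≈⟨ horner-+ m β _ _ ⟨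
      horner m β (λ i → ι (a i) + ι (b i))     ≈⟨ horner-congʳ m (λ i → +-homo (a i) (b i)) ⟨
      combination m β (λ i → a i F.+ b i)      ∎

    combination-*ˡ : ∀ k a → ι k * combination m β a ≈ combination m β (λ i → k F.* a i)
    combination-*ˡ k a = begin
      ι k * combination m β a             ≈⟨ horner-*ˡ m β (ι k) _ ⟨
      horner m β (λ i → ι k * ι (a i))    ≈⟨ horner-congʳ m (λ i → *-homo k (a i)) ⟨
      combination m β (λ i → k F.* a i)   ∎

    span-+ : ∀ {y z} → InSpan y → InSpan z → InSpan (y + z)
    span-+ (inSpan a y≈) (inSpan b z≈) =
      inSpan (λ i → a i F.+ b i) (trans (+-cong y≈ z≈) (combination-+ a b))

    span-*ˡ : ∀ {y} k → InSpan y → InSpan (ι k * y)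
    span-*ˡ k (inSpan a y≈) =
      inSpan (λ i → k F.* a i) (trans (*-congˡ y≈) (combination-*ˡ k a))

    span-0 : InSpan 0#
    span-0 = inSpan (λ _ → F.0#) (sym (combination-0 m β))

    span-1 : 0 < m → InSpan 1#
    span-1 0<m = inSpan (prepend F.1# (λ _ → F.0#)) (sym (combination-1 m 0<m β))

    -- The overflowing term of degree m is rewritten with βᵐ = − Σ hᵢ βⁱ.
    span-β* : ∀ h → MonicRelation h → ∀ {y} → InSpan y → InSpan (β * y)
    span-β* h hβ≈0 {y} (inSpan a y≈) = inSpan (λ i → s i F.+ (F.- s m) F.* h i) (begin
      β * y                                     ≈⟨ *-congˡ y≈ ⟩
      β * combination m β a                     ≈⟨ +-identityˡ _ ⟨
      0# + β * combination m β a                ≈⟨ +-congʳ 0#-homo ⟨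
      combination (suc m) β s                   ≈⟨ horner-last m β (ι ∘ s) ⟩
      combination m β s + ι (s m) * β ^ m       ≈⟨ +-congˡ overflow ⟩
      combination m β s + ι (F.- s m) * combination m β h
        ≈⟨ +-congˡ (combination-*ˡ (F.- s m) h) ⟩
      combination m β s + combination m β (λ i → (F.- s m) F.* h i)
        ≈⟨ combination-+ s (λ i → (F.- s m) F.* h i) ⟩
      combination m β (λ i → s i F.+ (F.- s m) F.* h i) ∎)
      where
      s : ℕ → F.Carrier
      s = prepend F.0# a

      overflow : ι (s m) * β ^ m ≈ ι (F.- s m) * combination m β h
      overflow = begin
        ι (s m) * β ^ m                 ≈⟨ *-congˡ (+-inverseʳ-unique _ _ hβ≈0) ⟩
        ι (s m) * - combination m β h   ≈⟨ -‿distribʳ-* _ _ ⟨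
        - (ι (s m) * combination m β h) ≈⟨ -‿distribˡ-* _ _ ⟩
        - ι (s m) * combination m β h   ≈⟨ *-congʳ (-‿homo (s m)) ⟨
        ι (F.- s m) * combination m β h ∎

    -- Horner's rule for y reduces the product to scaling and multiplication by β, both of which
    -- preserve the span. The number n of terms of y shrinks in the induction while the span keeps
    -- its length m.
    span-* : ∀ h → MonicRelation h → ∀ {y z} → InSpan y → InSpan z → InSpan (y * z)
    span-* h hβ≈0 {z = z} (inSpan a y≈) z∈ = span-resp-≈ (*-congʳ (sym y≈)) (times m a)
      where
      times : ∀ n a → InSpan (combination n β a * z)
      times zero    a = span-resp-≈ (sym (zeroˡ z)) span-0
      times (suc n) a = span-resp-≈
        (solve 4 (λ k z β t → k :* z :+ β :* (t :* z) := (k :+ β :* t) :* z) refl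
               (ι (a 0)) z β (combination n β (a ∘ suc)))
        (span-+ (span-*ˡ (a 0) z∈) (span-β* h hβ≈0 (times n (a ∘ suc))))

    -- Writing β as β · 1 also covers m = 1, where β is not among the powers βⁱ with i < m and is
    -- expressed through the relation.
    generator∈span : ∀ h → MonicRelation h → 0 < m → InSpan β
    generator∈span h hβ≈0 0<m = span-resp-≈ (*-identityʳ β) (span-β* h hβ≈0 (span-1 0<m))

-- The quotient of a commutative ring by a principal ideal.

module PrincipalQuotient {c ℓ} (P : CommutativeRing c ℓ) (f : CommutativeRing.Carrier P) where
  open RingExtras P

  infix 4 _≡f_
  record _≡f_ (a b : Carrier) : Set (c Level.⊔ ℓ) where
    constructor mod
    field
      quot  : Carrier
      eq    : a ≈ b + f * quot

  ≈⇒≡f : ∀ {a b} → a ≈ b → a ≡f b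
  ≈⇒≡f {a} {b} a≈b = mod 0# (trans a≈b (sym (trans (+-congˡ (zeroʳ f)) (+-identityʳ b))))

  -- Carrier and operations are those of P and only the equality is coarser, so a polynomial serves
  -- as its own residue class.
  quotientRing : CommutativeRing c (c Level.⊔ ℓ)
  quotientRing = record
    { Carrier = Carrier ; _≈_ = _≡f_ ; _+_ = _+_ ; _*_ = _*_ ; -_ = -_ ; 0# = 0# ; 1# = 1#
    ; isCommutativeRing = record
      { isRing = record
        { +-isAbelianGroup = record
          { isGroup = record
            { isMonoid = record
              { isSemigroup = record
                { isMagma = record
                  { isEquivalence = record { refl = ≈⇒≡f refl ; sym = sym-f ; trans = trans-f }
                  ; ∙-cong = +-cong-f }
                ; assoc = λ x y z → ≈⇒≡f (+-assoc x y z) }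
              ; identity = (λ x → ≈⇒≡f (+-identityˡ x)) , (λ x → ≈⇒≡f (+-identityʳ x)) }
            ; inverse = (λ x → ≈⇒≡f (-‿inverseˡ x)) , (λ x → ≈⇒≡f (-‿inverseʳ x))
            ; ⁻¹-cong = neg-cong-f }
          ; comm = λ x y → ≈⇒≡f (+-comm x y) }
        ; *-cong = *-cong-f
        ; *-assoc = λ x y z → ≈⇒≡f (*-assoc x y z)
        ; *-identity = (λ x → ≈⇒≡f (*-identityˡ x)) , (λ x → ≈⇒≡f (*-identityʳ x))
        ; distrib = (λ x y z → ≈⇒≡f (distribˡ x y z)) , (λ x y z → ≈⇒≡f (distribʳ x y z)) }
      ; *-comm = λ x y → ≈⇒≡f (*-comm x y) }
    }
    where
    sym-f : ∀ {a b} → a ≡f b → b ≡f a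
    sym-f {a} {b} (mod s a≈) = mod (- s) (begin
      b                        ≈⟨ +-identityʳ b ⟨
      b + 0#                   ≈⟨ +-congˡ (-‿inverseʳ (f * s)) ⟨
      b + (f * s - f * s)      ≈⟨ +-assoc _ _ _ ⟨
      (b + f * s) - f * s      ≈⟨ +-cong (sym a≈) (-‿distribʳ-* f s) ⟩
      a + f * - s              ∎)

    trans-f : ∀ {a b d} → a ≡f b → b ≡f d → a ≡f d
    trans-f {a} {b} {d} (mod s a≈) (mod t b≈) = mod (t + s) (begin
      a                      ≈⟨ a≈ ⟩
      b + f * s              ≈⟨ +-congʳ b≈ ⟩
      (d + f * t) + f * s    ≈⟨ solve 4 (λ d f t s → (d :+ f :* t) :+ f :* s := d :+ f :* (t :+ s)) refl d f t s ⟩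
      d + f * (t + s)        ∎)

    +-cong-f : ∀ {a b x y} → a ≡f b → x ≡f y → a + x ≡f b + y
    +-cong-f {a} {b} {x} {y} (mod s a≈) (mod t x≈) = mod (s + t) (begin
      a + x                      ≈⟨ +-cong a≈ x≈ ⟩
      (b + f * s) + (y + f * t)
        ≈⟨ solve 5 (λ b f s y t → (b :+ f :* s) :+ (y :+ f :* t) := (b :+ y) :+ f :* (s :+ t)) refl b f s y t ⟩
      (b + y) + f * (s + t)      ∎)

    *-cong-f : ∀ {a b x y} → a ≡f b → x ≡f y → a * x ≡f b * y
    *-cong-f {a} {b} {x} {y} (mod s a≈) (mod t x≈) = mod (s * y + b * t + f * (s * t)) (begin
      a * x                      ≈⟨ *-cong a≈ x≈ ⟩
      (b + f * s) * (y + f * t)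
        ≈⟨ solve 5 (λ b f s y t → (b :+ f :* s) :* (y :+ f :* t) := b :* y :+ f :* (s :* y :+ b :* t :+ f :* (s :* t)))
                 refl b f s y t ⟩
      b * y + f * (s * y + b * t + f * (s * t)) ∎)

    neg-cong-f : ∀ {a b} → a ≡f b → - a ≡f - b
    neg-cong-f {a} {b} (mod s a≈) = mod (- s) (begin
      - a              ≈⟨ -‿cong a≈ ⟩
      - (b + f * s)    ≈⟨ -‿+-comm _ _ ⟨
      - b - f * s      ≈⟨ +-congˡ (-‿distribʳ-* f s) ⟩
      - b + f * - s    ∎)

-- Counting m-tuples over a finite field.

module Enumeration {c ℓ} {F : CommutativeRing c ℓ} {q : ℕ} (finite : IsFiniteField F q) where
  open CommutativeRing F hiding (zero)
  open IsFiniteField finite using (card)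
  open Bijection card using (to; injective; surjective)

  record TupleEnumeration (m N : ℕ) : Set (c Level.⊔ ℓ) where
    field
      tuple          : Fin N → ℕ → Carrier
      tuple-injective : ∀ {j k} → (∀ i → i < m → tuple j i ≈ tuple k i) → j ≡ k
      tuple-surjective : ∀ (a : ℕ → Carrier) → ∃ λ k → ∀ i → i < m → tuple k i ≈ a i

  tuples : ∀ m → TupleEnumeration m (q ℕ.^ m)
  tuples zero = record
    { tuple = λ _ _ → 0#
    ; tuple-injective = λ { {zero} {zero} _ → ≡.refl }
    ; tuple-surjective = λ _ → zero , λ _ () }
  tuples (suc m) = record { tuple = tup ; tuple-injective = inj ; tuple-surjective = sur }
    where
    open TupleEnumeration (tuples m)

    cons : Fin q × Fin (q ℕ.^ m) → ℕ → Carrier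
    cons (x , k) zero    = to x
    cons (x , k) (suc i) = tuple k i

    split : Fin (q ℕ.^ suc m) → Fin q × Fin (q ℕ.^ m)
    split = Fin.remQuot {q} (q ℕ.^ m)

    tup : Fin (q ℕ.^ suc m) → ℕ → Carrier
    tup j = cons (split j)

    cons-injective : ∀ s t → (∀ i → i < suc m → cons s i ≈ cons t i) → s ≡ t
    cons-injective (x , j) (y , k) eq =
      ≡.cong₂ _,_ (injective (eq 0 z<s)) (tuple-injective (λ i i<m → eq (suc i) (s<s i<m)))

    inj : ∀ {j k} → (∀ i → i < suc m → tup j i ≈ tup k i) → j ≡ k
    inj {j} {k} eq = begin
      j                                          ≡⟨ Finₚ.combine-remQuot {q} (q ℕ.^ m) j ⟨
      uncurry Fin.combine (split j) ≡⟨ ≡.cong (uncurry Fin.combine) (cons-injective _ _ eq) ⟩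
      uncurry Fin.combine (split k) ≡⟨ Finₚ.combine-remQuot {q} (q ℕ.^ m) k ⟩
      k                                          ∎
      where open ≡.≡-Reasoning

    sur : ∀ (a : ℕ → Carrier) → ∃ λ k → ∀ i → i < suc m → tup k i ≈ a i
    sur a with surjective (a 0) | tuple-surjective (a ∘ suc)
    ... | x , x↦ | k , k↦ = Fin.combine x k , agree
      where
      agree : ∀ i → i < suc m → tup (Fin.combine x k) i ≈ a i
      agree i i<m rewrite Finₚ.remQuot-combine {q} x k with i
      ... | zero   = x↦ ≡.refl
      ... | suc i′ = k↦ i′ (ℕ.s<s⁻¹ i<m)

  -- Exhibiting the count as `suc N` makes N the number of tuples other than the zero tuple, which
  -- is the order of the group F(β) without 0.
  nonempty : ∀ {m M} → TupleEnumeration m M → ∃ λ N → TupleEnumeration m (suc N)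
  nonempty {M = zero}  e with TupleEnumeration.tuple-surjective e (λ _ → 0#)
  ... | () , _
  nonempty {M = suc N} e = N , e

-- The ring axioms for coefficient lists.

module PolynomialRing {c ℓ} (F : CommutativeRing c ℓ) where
  open RingExtras F
  open Poly F

  coeff-+ : ∀ p r i → coeff (p +ₚ r) i ≈ coeff p i + coeff r i
  coeff-+ []      r       i       = sym (+-identityˡ _)
  coeff-+ (a ∷ p) []      i       = sym (+-identityʳ _)
  coeff-+ (a ∷ p) (b ∷ r) zero    = refl
  coeff-+ (a ∷ p) (b ∷ r) (suc i) = coeff-+ p r i

  scale : Carrier → Polynomial → Polynomial
  scale a = map (a *_)

  coeff-scale : ∀ a r i → coeff (scale a r) i ≈ a * coeff r i
  coeff-scale a []      i       = sym (zeroʳ a)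
  coeff-scale a (b ∷ r) zero    = refl
  coeff-scale a (b ∷ r) (suc i) = coeff-scale a r i

  infix 8 -ₚ_
  -ₚ_ : Polynomial → Polynomial
  -ₚ_ = map (λ a → - a)

  coeff-neg : ∀ p i → coeff (-ₚ p) i ≈ - coeff p i
  coeff-neg []      i       = sym -0#≈0#
  coeff-neg (a ∷ p) zero    = refl
  coeff-neg (a ∷ p) (suc i) = coeff-neg p i

  coeff-∷* : ∀ a p r i → coeff ((a ∷ p) *ₚ r) i ≈ a * coeff r i + coeff (0# ∷ (p *ₚ r)) i
  coeff-∷* a p r i = trans (coeff-+ (scale a r) _ i) (+-congʳ (coeff-scale a r i))

  coeff-*0 : ∀ p r → coeff (p *ₚ r) 0 ≈ coeff p 0 * coeff r 0
  coeff-*0 []      r = sym (zeroˡ _)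
  coeff-*0 (a ∷ p) r = trans (coeff-∷* a p r 0) (+-identityʳ _)

  -- A record, so that unification recovers the two polynomials.
  infix 4 _≋_
  record _≋_ (p r : Polynomial) : Set ℓ where
    constructor coeffwise
    field
      coeff-≈ : p ≈ₚ r
  open _≋_ public

  ∷-cong : ∀ {a b p r} → a ≈ b → p ≋ r → a ∷ p ≋ b ∷ r
  ∷-cong a≈b p≋r = coeffwise λ { zero → a≈b ; (suc i) → coeff-≈ p≋r i }

  0∷[] : 0# ∷ [] ≋ []
  0∷[] = coeffwise λ { zero → refl ; (suc i) → refl }

  private
    +ₚ-cong : ∀ {p p′ r r′} → p ≋ p′ → r ≋ r′ → p +ₚ r ≋ p′ +ₚ r′
    +ₚ-cong {p} {p′} {r} {r′} p≋ r≋ = coeffwise λ i → begin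
      coeff (p +ₚ r) i          ≈⟨ coeff-+ p r i ⟩
      coeff p i + coeff r i     ≈⟨ +-cong (coeff-≈ p≋ i) (coeff-≈ r≋ i) ⟩
      coeff p′ i + coeff r′ i   ≈⟨ coeff-+ p′ r′ i ⟨
      coeff (p′ +ₚ r′) i        ∎

    +ₚ-assoc : ∀ p r s → (p +ₚ r) +ₚ s ≋ p +ₚ (r +ₚ s)
    +ₚ-assoc p r s = coeffwise λ i → begin
      coeff (p +ₚ r +ₚ s) i                  ≈⟨ coeff-+ (p +ₚ r) s i ⟩
      coeff (p +ₚ r) i + coeff s i           ≈⟨ +-congʳ (coeff-+ p r i) ⟩
      coeff p i + coeff r i + coeff s i      ≈⟨ +-assoc _ _ _ ⟩
      coeff p i + (coeff r i + coeff s i)    ≈⟨ +-congˡ (coeff-+ r s i) ⟨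
      coeff p i + coeff (r +ₚ s) i           ≈⟨ coeff-+ p (r +ₚ s) i ⟨
      coeff (p +ₚ (r +ₚ s)) i                ∎

    +ₚ-comm : ∀ p r → p +ₚ r ≋ r +ₚ p
    +ₚ-comm p r = coeffwise λ i → begin
      coeff (p +ₚ r) i       ≈⟨ coeff-+ p r i ⟩
      coeff p i + coeff r i  ≈⟨ +-comm _ _ ⟩
      coeff r i + coeff p i  ≈⟨ coeff-+ r p i ⟨
      coeff (r +ₚ p) i       ∎

    +ₚ-identityʳ : ∀ p → p +ₚ [] ≋ p
    +ₚ-identityʳ p = coeffwise λ i → trans (coeff-+ p [] i) (+-identityʳ _)

    -ₚ-inverseʳ : ∀ p → p +ₚ -ₚ p ≋ []
    -ₚ-inverseʳ p = coeffwise λ i → begin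
      coeff (p +ₚ -ₚ p) i         ≈⟨ coeff-+ p (-ₚ p) i ⟩
      coeff p i + coeff (-ₚ p) i  ≈⟨ +-congˡ (coeff-neg p i) ⟩
      coeff p i - coeff p i       ≈⟨ -‿inverseʳ _ ⟩
      0#                          ∎

    -ₚ-cong : ∀ {p r} → p ≋ r → -ₚ p ≋ -ₚ r
    -ₚ-cong {p} {r} p≋r = coeffwise λ i →
      trans (coeff-neg p i) (trans (-‿cong (coeff-≈ p≋r i)) (sym (coeff-neg r i)))

    ≋-refl : ∀ {p} → p ≋ p
    ≋-refl = coeffwise λ _ → refl

    ≋-sym : ∀ {p r} → p ≋ r → r ≋ p
    ≋-sym p≋r = coeffwise λ i → sym (coeff-≈ p≋r i)

    ≋-trans : ∀ {p r s} → p ≋ r → r ≋ s → p ≋ s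
    ≋-trans p≋r r≋s = coeffwise λ i → trans (coeff-≈ p≋r i) (coeff-≈ r≋s i)

    tail-≋ : ∀ {a b p r} → a ∷ p ≋ b ∷ r → p ≋ r
    tail-≋ eq = coeffwise λ i → coeff-≈ eq (suc i)

    tail-≋[] : ∀ {a p} → a ∷ p ≋ [] → p ≋ []
    tail-≋[] eq = coeffwise λ i → coeff-≈ eq (suc i)

    scale-cong : ∀ {a b p r} → a ≈ b → p ≋ r → scale a p ≋ scale b r
    scale-cong {a} {b} {p} {r} a≈b p≋r = coeffwise λ i →
      trans (coeff-scale a p i) (trans (*-cong a≈b (coeff-≈ p≋r i)) (sym (coeff-scale b r i)))

    scale-0 : ∀ r → scale 0# r ≋ []
    scale-0 r = coeffwise λ i → trans (coeff-scale 0# r i) (zeroˡ _)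

    *ₚ-zeroʳ : ∀ p → p *ₚ [] ≋ []
    *ₚ-zeroʳ []      = ≋-refl
    *ₚ-zeroʳ (a ∷ p) = ≋-trans (∷-cong refl (*ₚ-zeroʳ p)) 0∷[]

    *ₚ-zeroˡ : ∀ {p} r → p ≋ [] → p *ₚ r ≋ []
    *ₚ-zeroˡ {[]}    r _   = ≋-refl
    *ₚ-zeroˡ {a ∷ p} r a∷p≋ =
      +ₚ-cong (≋-trans (scale-cong (coeff-≈ a∷p≋ 0) ≋-refl) (scale-0 r))
              (≋-trans (∷-cong refl (*ₚ-zeroˡ r (tail-≋[] a∷p≋))) 0∷[])

    *ₚ-cong : ∀ {p p′ r r′} → p ≋ p′ → r ≋ r′ → p *ₚ r ≋ p′ *ₚ r′
    *ₚ-cong {[]}    {p′}     {r′ = r′} p≋ r≋ = ≋-sym (*ₚ-zeroˡ r′ (≋-sym p≋))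
    *ₚ-cong {a ∷ p} {[]}     {r}       p≋ r≋ = *ₚ-zeroˡ r p≋
    *ₚ-cong {a ∷ p} {b ∷ p′} p≋ r≋ =
      +ₚ-cong (scale-cong (coeff-≈ p≋ 0) r≋) (∷-cong refl (*ₚ-cong (tail-≋ p≋) r≋))

    *ₚ-distribʳ : ∀ s p r → (p +ₚ r) *ₚ s ≋ (p *ₚ s) +ₚ (r *ₚ s)
    *ₚ-distribʳ s []      r       = ≋-refl
    *ₚ-distribʳ s (a ∷ p) []      = ≋-sym (+ₚ-identityʳ _)
    *ₚ-distribʳ s (a ∷ p) (b ∷ r) = coeffwise λ i → begin
      coeff ((a + b ∷ p +ₚ r) *ₚ s) i                              ≈⟨ coeff-∷* (a + b) (p +ₚ r) s i ⟩
      (a + b) * coeff s i + coeff (0# ∷ ((p +ₚ r) *ₚ s)) i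
        ≈⟨ +-congˡ (shifted i) ⟩
      (a + b) * coeff s i + (coeff (0# ∷ (p *ₚ s)) i + coeff (0# ∷ (r *ₚ s)) i)
        ≈⟨ solve 5 (λ a b s u v → (a :+ b) :* s :+ (u :+ v) := (a :* s :+ u) :+ (b :* s :+ v)) refl a b _ _ _ ⟩
      (a * coeff s i + coeff (0# ∷ (p *ₚ s)) i) + (b * coeff s i + coeff (0# ∷ (r *ₚ s)) i)
        ≈⟨ +-cong (coeff-∷* a p s i) (coeff-∷* b r s i) ⟨
      coeff ((a ∷ p) *ₚ s) i + coeff ((b ∷ r) *ₚ s) i              ≈⟨ coeff-+ ((a ∷ p) *ₚ s) _ i ⟨
      coeff (((a ∷ p) *ₚ s) +ₚ ((b ∷ r) *ₚ s)) i                   ∎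
      where
      shifted : ∀ i → coeff (0# ∷ ((p +ₚ r) *ₚ s)) i ≈ coeff (0# ∷ (p *ₚ s)) i + coeff (0# ∷ (r *ₚ s)) i
      shifted zero    = sym (+-identityˡ 0#)
      shifted (suc i) = trans (coeff-≈ (*ₚ-distribʳ s p r) i) (coeff-+ (p *ₚ s) _ i)

    -- The product recurses on its left factor only. Expanding both sides brings them to a·r + b·p
    -- plus the shifted product of p and r, which takes the hypothesis with the left tail, with the
    -- right tail and with both tails.
    *ₚ-comm : ∀ p r → p *ₚ r ≋ r *ₚ p
    *ₚ-comm []      r       = ≋-sym (*ₚ-zeroʳ r)
    *ₚ-comm (a ∷ p) []      = *ₚ-zeroʳ (a ∷ p)
    *ₚ-comm (a ∷ p) (b ∷ r) = coeffwise (go (*ₚ-comm p (b ∷ r)) (*ₚ-comm p r) (*ₚ-comm (a ∷ p) r))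
      where
      go : p *ₚ (b ∷ r) ≋ (b ∷ r) *ₚ p → p *ₚ r ≋ r *ₚ p → (a ∷ p) *ₚ r ≋ r *ₚ (a ∷ p) →
           ∀ i → coeff ((a ∷ p) *ₚ (b ∷ r)) i ≈ coeff ((b ∷ r) *ₚ (a ∷ p)) i
      go _ _ _ zero = begin
        coeff ((a ∷ p) *ₚ (b ∷ r)) 0  ≈⟨ coeff-*0 (a ∷ p) (b ∷ r) ⟩
        a * b                         ≈⟨ *-comm a b ⟩
        b * a                         ≈⟨ coeff-*0 (b ∷ r) (a ∷ p) ⟨
        coeff ((b ∷ r) *ₚ (a ∷ p)) 0  ∎
      go ih₁ ih₂ ih₃ (suc i) = begin
        coeff ((a ∷ p) *ₚ (b ∷ r)) (suc i)               ≈⟨ coeff-∷* a p (b ∷ r) (suc i) ⟩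
        a * coeff r i + coeff (p *ₚ (b ∷ r)) i           ≈⟨ +-congˡ (coeff-≈ ih₁ i) ⟩
        a * coeff r i + coeff ((b ∷ r) *ₚ p) i           ≈⟨ +-congˡ (coeff-∷* b r p i) ⟩
        a * coeff r i + (b * coeff p i + coeff (0# ∷ (r *ₚ p)) i)
          ≈⟨ solve 3 (λ u v w → u :+ (v :+ w) := v :+ (u :+ w)) refl _ _ _ ⟩
        b * coeff p i + (a * coeff r i + coeff (0# ∷ (r *ₚ p)) i)
          ≈⟨ +-congˡ (+-congˡ (coeff-≈ (∷-cong refl ih₂) i)) ⟨
        b * coeff p i + (a * coeff r i + coeff (0# ∷ (p *ₚ r)) i)
          ≈⟨ +-congˡ (coeff-∷* a p r i) ⟨
        b * coeff p i + coeff ((a ∷ p) *ₚ r) i           ≈⟨ +-congˡ (coeff-≈ ih₃ i) ⟩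
        b * coeff p i + coeff (r *ₚ (a ∷ p)) i           ≈⟨ coeff-∷* b r (a ∷ p) (suc i) ⟨
        coeff ((b ∷ r) *ₚ (a ∷ p)) (suc i)               ∎

    scale-+ : ∀ a p r → scale a (p +ₚ r) ≋ scale a p +ₚ scale a r
    scale-+ a p r = coeffwise λ i → begin
      coeff (scale a (p +ₚ r)) i                 ≈⟨ coeff-scale a (p +ₚ r) i ⟩
      a * coeff (p +ₚ r) i                       ≈⟨ *-congˡ (coeff-+ p r i) ⟩
      a * (coeff p i + coeff r i)                ≈⟨ distribˡ a _ _ ⟩
      a * coeff p i + a * coeff r i              ≈⟨ +-cong (coeff-scale a p i) (coeff-scale a r i) ⟨
      coeff (scale a p) i + coeff (scale a r) i  ≈⟨ coeff-+ (scale a p) (scale a r) i ⟨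
      coeff (scale a p +ₚ scale a r) i           ∎

    scale-scale : ∀ a b p → scale (a * b) p ≋ scale a (scale b p)
    scale-scale a b p = coeffwise λ i → begin
      coeff (scale (a * b) p) i      ≈⟨ coeff-scale (a * b) p i ⟩
      a * b * coeff p i              ≈⟨ *-assoc a b _ ⟩
      a * (b * coeff p i)            ≈⟨ *-congˡ (coeff-scale b p i) ⟨
      a * coeff (scale b p) i        ≈⟨ coeff-scale a (scale b p) i ⟨
      coeff (scale a (scale b p)) i  ∎

    scale-* : ∀ a p r → scale a p *ₚ r ≋ scale a (p *ₚ r)
    scale-* a []      r = ≋-refl
    scale-* a (b ∷ p) r = ≋-sym (≋-trans (scale-+ a (scale b r) (0# ∷ (p *ₚ r)))
      (+ₚ-cong (≋-sym (scale-scale a b r)) (∷-cong (zeroʳ a) (≋-sym (scale-* a p r)))))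

    *ₚ-assoc : ∀ p r s → (p *ₚ r) *ₚ s ≋ p *ₚ (r *ₚ s)
    *ₚ-assoc []      r s = ≋-refl
    *ₚ-assoc (a ∷ p) r s = ≋-trans (*ₚ-distribʳ s (scale a r) (0# ∷ (p *ₚ r)))
      (+ₚ-cong (scale-* a r s) (≋-trans (+ₚ-cong (scale-0 s) ≋-refl) (∷-cong refl (*ₚ-assoc p r s))))

    *ₚ-identityˡ : ∀ p → oneP *ₚ p ≋ p
    *ₚ-identityˡ p = coeffwise λ i → begin
      coeff (oneP *ₚ p) i                  ≈⟨ coeff-∷* 1# [] p i ⟩
      1# * coeff p i + coeff (0# ∷ []) i   ≈⟨ +-cong (*-identityˡ _) (coeff-≈ 0∷[] i) ⟩
      coeff p i + 0#                       ≈⟨ +-identityʳ _ ⟩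
      coeff p i                            ∎

  polynomialRing : CommutativeRing c ℓ
  polynomialRing = record
    { Carrier = Polynomial ; _≈_ = _≋_ ; _+_ = _+ₚ_ ; _*_ = _*ₚ_ ; -_ = -ₚ_ ; 0# = zeroP ; 1# = oneP
    ; isCommutativeRing = record
      { isRing = record
        { +-isAbelianGroup = record
          { isGroup = record
            { isMonoid = record
              { isSemigroup = record
                { isMagma = record
                  { isEquivalence = record { refl = ≋-refl ; sym = ≋-sym ; trans = ≋-trans }
                  ; ∙-cong = +ₚ-cong }
                ; assoc = +ₚ-assoc }
              ; identity = (λ _ → ≋-refl) , +ₚ-identityʳ }
            ; inverse = (λ p → ≋-trans (+ₚ-comm (-ₚ p) p) (-ₚ-inverseʳ p)) , -ₚ-inverseʳ
            ; ⁻¹-cong = -ₚ-cong }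
          ; comm = +ₚ-comm }
        ; *-cong = *ₚ-cong
        ; *-assoc = *ₚ-assoc
        ; *-identity = *ₚ-identityˡ , (λ p → ≋-trans (*ₚ-comm p oneP) (*ₚ-identityˡ p))
        ; distrib = (λ s p r → ≋-trans (*ₚ-comm s (p +ₚ r)) (≋-trans (*ₚ-distribʳ s p r)
                                 (+ₚ-cong (*ₚ-comm p s) (*ₚ-comm r s))))
                    , *ₚ-distribʳ }
      ; *-comm = *ₚ-comm }
    }

-- Degree bounds, low-order coefficients and division with remainder.

module PolynomialProperties {c ℓ} (F : CommutativeRing c ℓ) where
  open RingExtras F
  open Poly F
  open PolynomialRing F public
  private module P = RingExtras polynomialRing

  0∷-* : ∀ p r → (0# ∷ p) *ₚ r ≋ 0# ∷ (p *ₚ r)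
  0∷-* p r = coeffwise λ i →
    trans (coeff-∷* 0# p r i) (trans (+-congʳ (zeroˡ _)) (+-identityˡ _))

  constP-isRingHomomorphism :
    IsRingHomomorphism rawRing (CommutativeRing.rawRing polynomialRing) constP
  constP-isRingHomomorphism = record
    { isSemiringHomomorphism = record
      { isNearSemiringHomomorphism = record
        { +-isMonoidHomomorphism = record
          { isMagmaHomomorphism = record
            { isRelHomomorphism = record { cong = λ a≈b → ∷-cong a≈b P.refl }
            ; homo = λ _ _ → P.refl }
          ; ε-homo = 0∷[] }
        ; *-homo = λ a b → ∷-cong (sym (+-identityʳ _)) P.refl }
      ; 1#-homo = P.refl }
    ; -‿homo = λ _ → P.refl }

  -- A strict degree bound: `Below (suc d)` unfolds to `DegreeAtMost d`, and `Below 0` holds exactly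
  -- for the zero polynomial.
  Below : ℕ → Polynomial → Set ℓ
  Below d p = ∀ i → d ≤ i → coeff p i ≈ 0#

  below-mono : ∀ {d e} p → d ≤ e → Below d p → Below e p
  below-mono p d≤e below i e≤i = below i (ℕₚ.≤-trans d≤e e≤i)

  below-resp : ∀ {d p r} → p ≋ r → Below d p → Below d r
  below-resp p≋r below i d≤i = trans (sym (coeff-≈ p≋r i)) (below i d≤i)

  below-+ : ∀ {d} p r → Below d p → Below d r → Below d (p +ₚ r)
  below-+ p r p< r< i d≤i =
    trans (coeff-+ p r i) (trans (+-cong (p< i d≤i) (r< i d≤i)) (+-identityˡ 0#))

  below-neg : ∀ {d} p → Below d p → Below d (-ₚ p)
  below-neg p p< i d≤i = trans (coeff-neg p i) (trans (-‿cong (p< i d≤i)) -0#≈0#)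

  below-constP : ∀ a → Below 1 (constP a)
  below-constP a (suc i) _ = refl

  -- One bound is strict (deg p < d) and the other is not (deg r ≤ e), so that the bounds add up
  -- without a truncated subtraction.
  below-* : ∀ {d e} p r → Below d p → Below (suc e) r → Below (d ℕ.+ e) (p *ₚ r)
  below-* []      r p< r< i _ = refl
  below-* {d} {e} (a ∷ p) r p< r< i d+e≤i = begin
    coeff ((a ∷ p) *ₚ r) i                     ≈⟨ coeff-∷* a p r i ⟩
    a * coeff r i + coeff (0# ∷ (p *ₚ r)) i    ≈⟨ +-cong (head d i p< d+e≤i) (tail d i p< d+e≤i) ⟩
    0# + 0#                                    ≈⟨ +-identityˡ 0# ⟩
    0#                                         ∎
    where
    head : ∀ d i → Below d (a ∷ p) → d ℕ.+ e ≤ i → a * coeff r i ≈ 0#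
    head zero    i a∷p< _ = trans (*-congʳ (a∷p< 0 z≤n)) (zeroˡ _)
    head (suc d) i a∷p< le = trans (*-congˡ (r< i (ℕₚ.≤-trans (s≤s (ℕₚ.m≤n+m e d)) le))) (zeroʳ a)

    tail : ∀ d i → Below d (a ∷ p) → d ℕ.+ e ≤ i → coeff (0# ∷ (p *ₚ r)) i ≈ 0#
    tail d       zero    _ _ = refl
    tail zero    (suc i) a∷p< _ =
      coeff-≈ (P.*-congʳ {r} {p} {[]} (coeffwise λ j → a∷p< (suc j) z≤n)) i
    tail (suc d) (suc i) a∷p< (s≤s le) = below-* p r (λ j d≤j → a∷p< (suc j) (s≤s d≤j)) r< i le

  below-^ : ∀ {e} g k → Below (suc e) g → Below (suc (k ℕ.* e)) (g ^ₚ k)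
  below-^ g zero        g< = below-constP 1#
  below-^ {e} g (suc k) g< = below-* {suc e} {k ℕ.* e} g (g ^ₚ k) g< (below-^ g k g<)

  coeff-^ₚ0 : ∀ g k → coeff g 0 ≈ 1# → coeff (g ^ₚ k) 0 ≈ 1#
  coeff-^ₚ0 g zero    g₀≈1 = refl
  coeff-^ₚ0 g (suc k) g₀≈1 =
    trans (coeff-*0 g (g ^ₚ k)) (trans (*-cong g₀≈1 (coeff-^ₚ0 g k g₀≈1)) (*-identityˡ 1#))

  coeff-X^*-+ : ∀ n p i → coeff (X^ n *ₚ p) (n ℕ.+ i) ≈ coeff p i
  coeff-X^*-+ zero    p i = coeff-≈ (P.*-identityˡ p) i
  coeff-X^*-+ (suc n) p i = trans (coeff-≈ (0∷-* (X^ n) p) (suc (n ℕ.+ i))) (coeff-X^*-+ n p i)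

  coeff-X^*-< : ∀ n p i → i < n → coeff (X^ n *ₚ p) i ≈ 0#
  coeff-X^*-< (suc n) p zero    _       = coeff-≈ (0∷-* (X^ n) p) 0
  coeff-X^*-< (suc n) p (suc i) (s≤s i<n) =
    trans (coeff-≈ (0∷-* (X^ n) p) (suc i)) (coeff-X^*-< n p i i<n)

  below-X^* : ∀ n {d} p → Below d p → Below (n ℕ.+ d) (X^ n *ₚ p)
  below-X^* n {d} p p< i n+d≤i = ≡.subst (λ j → coeff (X^ n *ₚ p) j ≈ 0#) (ℕₚ.m+[n∸m]≡n n≤i)
    (trans (coeff-X^*-+ n p (i ∸ n)) (p< (i ∸ n)
      (ℕₚ.≤-trans (ℕₚ.≤-reflexive (≡.sym (ℕₚ.m+n∸m≡n n d))) (ℕₚ.∸-monoˡ-≤ n n+d≤i))))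
    where
    n≤i : n ≤ i
    n≤i = ℕₚ.≤-trans (ℕₚ.m≤m+n n d) n+d≤i

  X^-+ : ∀ a b → X^ (a ℕ.+ b) ≋ X^ a *ₚ X^ b
  X^-+ zero    b = P.sym (P.*-identityˡ (X^ b))
  X^-+ (suc a) b = P.trans (∷-cong refl (X^-+ a b)) (P.sym (0∷-* (X^ a) (X^ b)))

  -- The constant term 1 makes r invertible modulo Xⁿ; the coefficients of p are read off one after
  -- another from the lowest.
  vanishes-below : ∀ n p r → coeff r 0 ≈ 1# → (∀ i → i < n → coeff (p *ₚ r) i ≈ 0#) →
                   ∀ i → i < n → coeff p i ≈ 0#
  vanishes-below n       []      r r₀≈1 pr≈0 i i<n = refl
  vanishes-below (suc n) (a ∷ p) r r₀≈1 pr≈0 = go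
    where
    a≈0 : a ≈ 0#
    a≈0 = begin
      a                      ≈⟨ *-identityʳ a ⟨
      a * 1#                 ≈⟨ *-congˡ r₀≈1 ⟨
      a * coeff r 0          ≈⟨ coeff-*0 (a ∷ p) r ⟨
      coeff ((a ∷ p) *ₚ r) 0 ≈⟨ pr≈0 0 z<s ⟩
      0#                     ∎

    go : ∀ i → i < suc n → coeff (a ∷ p) i ≈ 0#
    go zero    _         = a≈0
    go (suc i) (s≤s i<n) = vanishes-below n p r r₀≈1 rest i i<n
      where
      rest : ∀ i → i < n → coeff (p *ₚ r) i ≈ 0#
      rest i i<n = begin
        coeff (p *ₚ r) i                             ≈⟨ +-identityˡ _ ⟨
        0# + coeff (p *ₚ r) i                        ≈⟨ +-congʳ (trans (*-congʳ a≈0) (zeroˡ _)) ⟨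
        a * coeff r (suc i) + coeff (p *ₚ r) i       ≈⟨ coeff-∷* a p r (suc i) ⟨
        coeff ((a ∷ p) *ₚ r) (suc i)                 ≈⟨ pr≈0 (suc i) (s≤s i<n) ⟩
        0#                                           ∎

  -- Above degree D the constant term a of the multiplier contributes nothing, so its tail v meets
  -- the same hypothesis. Once v vanishes, the coefficient at D of the product is a itself.
  low-multiple-of-monic : ∀ {D} f v → coeff f D ≈ 1# → Below (suc D) f → Below D (v *ₚ f) → v ≋ []
  low-multiple-of-monic f []      _ _ _ = P.refl
  low-multiple-of-monic {D} f (a ∷ v) f_D≈1 f< vf< =
    coeffwise λ { zero → a≈0 ; (suc i) → coeff-≈ v≋0 i }
    where
    v≋0 : v ≋ []
    v≋0 = low-multiple-of-monic f v f_D≈1 f< λ i D≤i → begin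
      coeff (v *ₚ f) i                         ≈⟨ +-identityˡ _ ⟨
      0# + coeff (v *ₚ f) i                    ≈⟨ +-congʳ (trans (*-congˡ (f< (suc i) (s≤s D≤i))) (zeroʳ a)) ⟨
      a * coeff f (suc i) + coeff (v *ₚ f) i   ≈⟨ coeff-∷* a v f (suc i) ⟨
      coeff ((a ∷ v) *ₚ f) (suc i)             ≈⟨ vf< (suc i) (ℕₚ.m≤n⇒m≤1+n D≤i) ⟩
      0#                                       ∎

    a≈0 : a ≈ 0#
    a≈0 = begin
      a                                             ≈⟨ *-identityʳ a ⟨
      a * 1#                                        ≈⟨ *-congˡ f_D≈1 ⟨
      a * coeff f D                                 ≈⟨ +-identityʳ _ ⟨
      a * coeff f D + 0#
        ≈⟨ +-congˡ (coeff-≈ (P.trans (∷-cong refl (P.*-congʳ {f} v≋0)) 0∷[]) D) ⟨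
      a * coeff f D + coeff (0# ∷ (v *ₚ f)) D       ≈⟨ coeff-∷* a v f D ⟨
      coeff ((a ∷ v) *ₚ f) D                        ≈⟨ vf< D ℕₚ.≤-refl ⟩
      0#                                            ∎

  -- If p = s b + r with deg r < d, then X p + a = X s b + (X r + a). The new remainder has degree
  -- at most d, so subtracting a single multiple t b repairs it.
  divide : ∀ {d u} b → coeff b d * u ≈ 1# → Below (suc d) b → ∀ p →
           ∃₂ λ s r → p ≋ (s *ₚ b) +ₚ r × Below d r
  divide b b_d*u≈1 b< []      = [] , [] , P.refl , λ _ _ → refl
  divide {d} {u} b b_d*u≈1 b< (a ∷ p) with divide b b_d*u≈1 b< p
  ... | s , r , p≋ , r< = t ∷ s , (a ∷ r) +ₚ -ₚ scale t b , a∷p≋ , low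
    where
    -- The coefficient at d of X r + a over the leading coefficient of b; for d = 0 it is read from
    -- a.
    t : Carrier
    t = coeff (a ∷ r) d * u

    a∷p≋ : a ∷ p ≋ ((t ∷ s) *ₚ b) +ₚ ((a ∷ r) +ₚ -ₚ scale t b)
    a∷p≋ = P.begin
      a ∷ p                                         P.≈⟨ ∷-cong (sym (+-identityˡ a)) p≋ ⟩
      (0# ∷ (s *ₚ b)) +ₚ (a ∷ r)                    P.≈⟨ P.+-identityˡ _ ⟨
      [] +ₚ ((0# ∷ (s *ₚ b)) +ₚ (a ∷ r))
        P.≈⟨ P.+-congʳ {(0# ∷ (s *ₚ b)) +ₚ (a ∷ r)} (P.-‿inverseʳ (scale t b)) ⟨
      (scale t b +ₚ -ₚ scale t b) +ₚ ((0# ∷ (s *ₚ b)) +ₚ (a ∷ r))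
        P.≈⟨ P.solve 4 (λ x y z w → (x P.:+ y) P.:+ (z P.:+ w) P.:= (x P.:+ z) P.:+ (w P.:+ y)) P.refl
                     (scale t b) (-ₚ scale t b) (0# ∷ (s *ₚ b)) (a ∷ r) ⟩
      ((t ∷ s) *ₚ b) +ₚ ((a ∷ r) +ₚ -ₚ scale t b)   P.∎

    coeff-rest : ∀ i → coeff ((a ∷ r) +ₚ -ₚ scale t b) i ≈ coeff (a ∷ r) i - t * coeff b i
    coeff-rest i = trans (coeff-+ (a ∷ r) (-ₚ scale t b) i)
      (+-congˡ (trans (coeff-neg (scale t b) i) (-‿cong (coeff-scale t b i))))

    t*b_d : t * coeff b d ≈ coeff (a ∷ r) d
    t*b_d = begin
      coeff (a ∷ r) d * u * coeff b d
        ≈⟨ solve 3 (λ x y z → x :* y :* z := x :* (z :* y)) refl _ u (coeff b d) ⟩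
      coeff (a ∷ r) d * (coeff b d * u)  ≈⟨ *-congˡ b_d*u≈1 ⟩
      coeff (a ∷ r) d * 1#               ≈⟨ *-identityʳ _ ⟩
      coeff (a ∷ r) d                    ∎

    low : Below d ((a ∷ r) +ₚ -ₚ scale t b)
    low i d≤i = trans (coeff-rest i) (≈⇒-≈0 (sym (cancels i (ℕₚ.m≤n⇒m<n∨m≡n d≤i))))
      where
      cancels : ∀ i → d < i ⊎ d ≡ i → t * coeff b i ≈ coeff (a ∷ r) i
      cancels i       (inj₂ ≡.refl)    = t*b_d
      cancels (suc i) (inj₁ d<i@(s≤s d≤i)) =
        trans (*-congˡ (b< (suc i) d<i)) (trans (zeroʳ t) (sym (r< i d≤i)))

  -- Homogenised forms and their triangularity.

  -- The homogenisation Σ_{i<k} Cᵢ X^{n i} g^{k−1−i} of Σ_{i<k} Cᵢ Yⁱ at Y = Xⁿ / g.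
  form : ℕ → Polynomial → ℕ → (ℕ → Polynomial) → Polynomial
  form n g zero    C = []
  form n g (suc k) C = (C 0 *ₚ (g ^ₚ k)) +ₚ (X^ n *ₚ form n g k (C ∘ suc))

  compose≋form : ∀ m n g h → compose m n g h ≋ form n g (suc m) (constP ∘ coeff h)
  compose≋form m n g h = go m (coeff h)
    where
    term : ℕ → (ℕ → Carrier) → ℕ → Polynomial
    term m a i = constP (a i) *ₚ (X^ (n ℕ.* i) *ₚ (g ^ₚ (m ∸ i)))

    sumP-factor : ∀ {t u} s N → (∀ i → t i ≋ s *ₚ u i) → sumP (applyUpTo t N) ≋ s *ₚ sumP (applyUpTo u N)
    sumP-factor s zero    t≋ = P.sym (P.zeroʳ s)
    sumP-factor {t} {u} s (suc N) t≋ = P.trans (P.+-cong (t≋ 0) (sumP-factor s N (t≋ ∘ suc)))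
      (P.sym (P.distribˡ s (u 0) (sumP (applyUpTo (u ∘ suc) N))))

    term-zero : ∀ m a → term m a 0 ≋ constP (a 0) *ₚ (g ^ₚ m)
    term-zero m a rewrite ℕₚ.*-zeroʳ n = P.*-congˡ {constP (a 0)} (P.*-identityˡ (g ^ₚ m))

    term-suc : ∀ m a i → term (suc m) a (suc i) ≋ X^ n *ₚ term m (a ∘ suc) i
    term-suc m a i rewrite ℕₚ.*-suc n i = P.begin
      constP (a (suc i)) *ₚ (X^ (n ℕ.+ n ℕ.* i) *ₚ (g ^ₚ (m ∸ i)))
        P.≈⟨ P.*-congˡ {constP (a (suc i))} (P.*-congʳ {g ^ₚ (m ∸ i)} (X^-+ n (n ℕ.* i))) ⟩
      constP (a (suc i)) *ₚ ((X^ n *ₚ X^ (n ℕ.* i)) *ₚ (g ^ₚ (m ∸ i)))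
        P.≈⟨ P.solve 4 (λ x y z w → x P.:* ((y P.:* z) P.:* w) P.:= y P.:* (x P.:* (z P.:* w))) P.refl
                     (constP (a (suc i))) (X^ n) (X^ (n ℕ.* i)) (g ^ₚ (m ∸ i)) ⟩
      X^ n *ₚ (constP (a (suc i)) *ₚ (X^ (n ℕ.* i) *ₚ (g ^ₚ (m ∸ i)))) P.∎

    go : ∀ m a → sumP (applyUpTo (term m a) (suc m)) ≋ form n g (suc m) (constP ∘ a)
    go zero    a = P.+-cong (term-zero 0 a) (P.sym (P.zeroʳ (X^ n)))
    go (suc m) a = P.+-cong (term-zero (suc m) a) (P.trans
      (sumP-factor (X^ n) (suc m) (term-suc m a))
      (P.*-congˡ {X^ n} (go m (a ∘ suc))))

  module _ {n : ℕ} {g : Polynomial} (g< : Below (suc n) g) where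

    -- Here `suc n` is the n of the theorem, so deg g ≤ n. Term i has degree at most n + (n+1)i +
    -- n(k-1-i) = nk + i, and i < k.
    below-form : ∀ k C → (∀ i → Below (suc n) (C i)) → Below (k ℕ.* suc n) (form (suc n) g k C)
    below-form zero    C C< = λ _ _ → refl
    below-form (suc k) C C< = below-+ first _
      (below-mono first (ℕₚ.+-monoʳ-≤ (suc n) (ℕₚ.*-monoʳ-≤ k (ℕₚ.n≤1+n n)))
                  (below-* (C 0) (g ^ₚ k) (C< 0) (below-^ g k g<)))
      (below-X^* (suc n) (form (suc n) g k (C ∘ suc)) (below-form k (C ∘ suc) (C< ∘ suc)))
      where
      first : Polynomial
      first = C 0 *ₚ (g ^ₚ k)

    -- With constant coefficients, term i has degree at most nk + i, so only the term i = k reaches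
    -- degree k(n+1). Applied to h, this makes f monic of degree mn.
    form-leading : ∀ k a → coeff (form (suc n) g (suc k) (constP ∘ a)) (k ℕ.* suc n) ≈ a k
                   × Below (suc (k ℕ.* suc n)) (form (suc n) g (suc k) (constP ∘ a))
    form-leading zero a = coeff-≈ form≋ 0 , below-resp (P.sym form≋) (below-constP (a 0))
      where
      form≋ : form (suc n) g 1 (constP ∘ a) ≋ constP (a 0)
      form≋ = P.trans (P.+-cong (P.*-identityʳ (constP (a 0))) (P.zeroʳ (X^ (suc n)))) (P.+-identityʳ _)
    form-leading (suc k) a = lead , low
      where
      first rest : Polynomial
      first = constP (a 0) *ₚ (g ^ₚ suc k)
      rest  = form (suc n) g (suc k) (constP ∘ a ∘ suc)

      first< : Below (suc k ℕ.* suc n) first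
      first< = below-mono first (s≤s (ℕₚ.+-monoʳ-≤ n (ℕₚ.*-monoʳ-≤ k (ℕₚ.n≤1+n n))))
                 (below-* (constP (a 0)) (g ^ₚ suc k) (below-constP (a 0)) (below-^ g (suc k) g<))

      lead : coeff (first +ₚ (X^ (suc n) *ₚ rest)) (suc k ℕ.* suc n) ≈ a (suc k)
      lead = begin
        coeff (first +ₚ (X^ (suc n) *ₚ rest)) (suc k ℕ.* suc n)
          ≈⟨ coeff-+ first _ (suc k ℕ.* suc n) ⟩
        coeff first (suc k ℕ.* suc n) + coeff (X^ (suc n) *ₚ rest) (suc k ℕ.* suc n)
          ≈⟨ +-cong (first< _ ℕₚ.≤-refl) (coeff-X^*-+ (suc n) rest (k ℕ.* suc n)) ⟩
        0# + coeff rest (k ℕ.* suc n)   ≈⟨ +-identityˡ _ ⟩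
        coeff rest (k ℕ.* suc n)        ≈⟨ proj₁ (form-leading k (a ∘ suc)) ⟩
        a (suc k)                       ∎

      low : Below (suc (suc k ℕ.* suc n)) (first +ₚ (X^ (suc n) *ₚ rest))
      low = below-+ first _ (below-mono first (ℕₚ.n≤1+n _) first<)
        (below-mono (X^ (suc n) *ₚ rest) (ℕₚ.≤-reflexive (ℕₚ.+-suc (suc n) (k ℕ.* suc n)))
                    (below-X^* (suc n) rest (proj₂ (form-leading k (a ∘ suc)))))

    -- g(0) = 1 makes the form triangular: C₀ is read off modulo Xⁿ, then C₁, and so on.
    form-injective : coeff g 0 ≈ 1# → ∀ k C → (∀ i → Below (suc n) (C i)) →
                     form (suc n) g k C ≋ [] → ∀ i → i < k → C i ≋ []
    form-injective g₀≈1 (suc k) C C< form≋0 = λ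
      { zero    _         → C₀≋0
      ; (suc i) (s≤s i<k) → form-injective g₀≈1 k (C ∘ suc) (C< ∘ suc) rest≋0 i i<k }
      where
      rest : Polynomial
      rest = form (suc n) g k (C ∘ suc)

      low : ∀ i → i < suc n → coeff (C 0 *ₚ (g ^ₚ k)) i ≈ 0#
      low i i<n = begin
        coeff (C 0 *ₚ (g ^ₚ k)) i                                    ≈⟨ +-identityʳ _ ⟨
        coeff (C 0 *ₚ (g ^ₚ k)) i + 0#                               ≈⟨ +-congˡ (coeff-X^*-< (suc n) rest i i<n) ⟨
        coeff (C 0 *ₚ (g ^ₚ k)) i + coeff (X^ (suc n) *ₚ rest) i     ≈⟨ coeff-+ (C 0 *ₚ (g ^ₚ k)) _ i ⟨
        coeff (form (suc n) g (suc k) C) i                           ≈⟨ coeff-≈ form≋0 i ⟩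
        0#                                                           ∎

      C₀≋0 : C 0 ≋ []
      C₀≋0 = coeffwise λ i → case i (ℕₚ.<-≤-connex i (suc n))
        where
        case : ∀ i → i < suc n ⊎ suc n ≤ i → coeff (C 0) i ≈ 0#
        case i (inj₁ i<n) = vanishes-below (suc n) (C 0) (g ^ₚ k) (coeff-^ₚ0 g k g₀≈1) low i i<n
        case i (inj₂ n≤i) = C< 0 i n≤i

      rest≋0 : rest ≋ []
      rest≋0 = coeffwise λ i → begin
        coeff rest i                                   ≈⟨ coeff-X^*-+ (suc n) rest i ⟨
        coeff (X^ (suc n) *ₚ rest) (suc n ℕ.+ i)       ≈⟨ +-identityˡ _ ⟨
        0# + coeff (X^ (suc n) *ₚ rest) (suc n ℕ.+ i)
          ≈⟨ +-congʳ (coeff-≈ (P.*-congʳ {g ^ₚ k} C₀≋0) (suc n ℕ.+ i)) ⟨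
        coeff (C 0 *ₚ (g ^ₚ k)) (suc n ℕ.+ i) + coeff (X^ (suc n) *ₚ rest) (suc n ℕ.+ i)
          ≈⟨ coeff-+ (C 0 *ₚ (g ^ₚ k)) _ (suc n ℕ.+ i) ⟨
        coeff (form (suc n) g (suc k) C) (suc n ℕ.+ i) ≈⟨ coeff-≈ form≋0 (suc n ℕ.+ i) ⟩
        0#                                             ∎

-- F[X]/(f) is a field.

module IrreducibleQuotient {c ℓ} {F : CommutativeRing c ℓ} {q : ℕ} (finite : IsFiniteField F q)
  (D : ℕ) (f : Poly.Polynomial F) (irreducible : Poly.Irreducible F f)
  (f_D≈1 : CommutativeRing._≈_ F (Poly.coeff F f D) (CommutativeRing.1# F))
  (f< : PolynomialProperties.Below F (suc D) f)
  where
  open RingExtras F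
  open IsFiniteField finite using (inverse; _≟_)
  open Poly F
  open PolynomialProperties F
  open PrincipalQuotient polynomialRing f
  private
    module P = RingExtras polynomialRing
    module K = RingExtras quotientRing

  -- Trailing zeros hide the degree of a coefficient list; decidable equality in F recovers it.
  zero-or-degree : ∀ p → p ≋ [] ⊎ ∃ λ d → ¬ coeff p d ≈ 0# × Below (suc d) p
  zero-or-degree []      = inj₁ P.refl
  zero-or-degree (a ∷ p) with zero-or-degree p
  ... | inj₂ (d , p_d≉0 , p<) = inj₂ (suc d , p_d≉0 , λ { (suc i) (s≤s d<i) → p< i d<i })
  ... | inj₁ p≋0 with a ≟ 0#
  ...   | yes a≈0 = inj₁ (P.trans (∷-cong a≈0 p≋0) 0∷[])
  ...   | no  a≉0 = inj₂ (0 , a≉0 , λ { (suc i) _ → coeff-≈ p≋0 i })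

  -- The way back from K to F[X]: a nonzero multiple of the monic f has degree at least D.
  ≡f0⇒≋0 : ∀ {a} → a ≡f [] → Below D a → a ≋ []
  ≡f0⇒≋0 {a} (mod s a≋fs) a< = P.trans a≋sf (P.*-congʳ {f} s≋0)
    where
    a≋sf : a ≋ s *ₚ f
    a≋sf = P.trans a≋fs (P.*-comm f s)
    s≋0 : s ≋ []
    s≋0 = low-multiple-of-monic f s f_D≈1 f< (below-resp a≋sf a<)

  f≡f0 : f ≡f []
  f≡f0 = mod oneP (P.sym (P.*-identityʳ f))

  -- f = s b + r gives r ≡ −s b (mod f), so an inverse of the remainder r yields one of b.
  inverse-mod : ∀ d → d ≤ D → ∀ b → Below d b → ¬ b ≋ [] → ∃ λ u → u *ₚ b ≡f oneP
  inverse-mod zero    _   b b< b≉0 = contradiction (coeffwise λ i → b< i z≤n) b≉0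
  inverse-mod (suc d) d<D b b< b≉0 with zero-or-degree b
  ... | inj₁ b≋0 = contradiction b≋0 b≉0
  ... | inj₂ (e , b_e≉0 , b<′) with divide b (proj₂ (inverse (coeff b e) b_e≉0)) b<′ f
  ...   | s , r , f≋sb+r , r< with zero-or-degree r
  ...     | inj₁ r≋0 = factors (proj₂ (proj₂ irreducible) s b (coeff-≈ f≋sb))
    where
    f≋sb : f ≋ s *ₚ b
    f≋sb = P.trans f≋sb+r (P.trans (P.+-congˡ {s *ₚ b} r≋0) (P.+-identityʳ _))

    factors : IsUnit s ⊎ IsUnit b → ∃ λ u → u *ₚ b ≡f oneP
    factors (inj₂ (u , bu≈1)) = u , ≈⇒≡f (P.trans (P.*-comm u b) (coeffwise bu≈1))
    -- If s is a unit, b is a multiple of f of degree below deg f, hence zero.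
    factors (inj₁ (v , sv≈1)) = contradiction (≡f0⇒≋0 b≡f0 (below-mono b d<D b<)) b≉0
      where
      b≡f0 : b ≡f []
      b≡f0 = mod v (P.begin
        b                   P.≈⟨ P.*-identityˡ b ⟨
        oneP *ₚ b           P.≈⟨ P.*-congʳ {b} {s *ₚ v} (coeffwise sv≈1) ⟨
        (s *ₚ v) *ₚ b       P.≈⟨ P.solve 3 (λ s v b → (s P.:* v) P.:* b P.:= (s P.:* b) P.:* v) P.refl s v b ⟩
        (s *ₚ b) *ₚ v       P.≈⟨ P.*-congʳ {v} f≋sb ⟨
        f *ₚ v              P.∎)
  ...     | inj₂ (e′ , r_e′≉0 , _) with inverse-mod d (ℕₚ.<⇒≤ d<D) r (below-mono r e≤d r<) r≉0
    where
    e≤d : e ≤ d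
    e≤d = ℕₚ.≮⇒≥ λ d<e → b_e≉0 (b< e d<e)
    r≉0 : ¬ r ≋ []
    r≉0 r≋0 = r_e′≉0 (coeff-≈ r≋0 e′)
  ...       | u , ur≡1 = u *ₚ (-ₚ s) , K.trans flip ur≡1
    where
    r≡-sb : r ≡f -ₚ (s *ₚ b)
    r≡-sb = K.+-inverseʳ-unique _ _ (K.trans (≈⇒≡f (P.sym f≋sb+r)) f≡f0)

    flip : (u *ₚ (-ₚ s)) *ₚ b ≡f u *ₚ r
    flip = K.trans (K.*-assoc u (-ₚ s) b)
      (K.*-congˡ {u} (K.trans (K.sym (K.-‿distribˡ-* s b)) (K.sym r≡-sb)))

  zero-or-inverse : ∀ a → a ≡f [] ⊎ ∃ λ u → u *ₚ a ≡f oneP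
  zero-or-inverse a with divide f (trans (*-identityʳ _) f_D≈1) f< a
  ... | s , r , a≋sf+r , r< = conclude (zero-or-degree r)
    where
    a≡r : a ≡f r
    a≡r = mod s (P.trans a≋sf+r (P.trans (P.+-comm (s *ₚ f) r) (P.+-congˡ {r} (P.*-comm s f))))

    conclude : r ≋ [] ⊎ (∃ λ d → ¬ coeff r d ≈ 0# × Below (suc d) r) → a ≡f [] ⊎ ∃ λ u → u *ₚ a ≡f oneP
    conclude (inj₁ r≋0) = inj₁ (K.trans a≡r (≈⇒≡f r≋0))
    conclude (inj₂ (d , r_d≉0 , _)) with inverse-mod D ℕₚ.≤-refl r r< (λ r≋0 → r_d≉0 (coeff-≈ r≋0 d))
    ... | u , ur≡1 = inj₂ (u , K.trans (K.*-congˡ {u} a≡r) ur≡1)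

  quotient-isDomain : IsDomain quotientRing
  quotient-isDomain = record { 1≉0 = 1≢f0 ; noZeroDivisors = noZeroDivisors }
    where
    1≢f0 : ¬ oneP ≡f []
    1≢f0 (mod s 1≋fs) = proj₁ (proj₂ irreducible) (s , coeff-≈ (P.sym 1≋fs))

    noZeroDivisors : ∀ a b → a *ₚ b ≡f [] → a ≡f [] ⊎ b ≡f []
    noZeroDivisors a b ab≡0 with zero-or-inverse a
    ... | inj₁ a≡0        = inj₁ a≡0
    ... | inj₂ (u , ua≡1) = inj₂ (K.begin
      b                 K.≈⟨ K.*-identityˡ b ⟨
      oneP *ₚ b         K.≈⟨ K.*-congʳ {b} ua≡1 ⟨
      (u *ₚ a) *ₚ b     K.≈⟨ K.*-assoc u a b ⟩
      u *ₚ (a *ₚ b)     K.≈⟨ K.*-congˡ {u} ab≡0 ⟩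
      u *ₚ []           K.≈⟨ K.zeroʳ u ⟩
      []                K.∎)

  ι-isRingHomomorphism : IsRingHomomorphism rawRing (CommutativeRing.rawRing quotientRing) constP
  ι-isRingHomomorphism = record
    { isSemiringHomomorphism = record
      { isNearSemiringHomomorphism = record
        { +-isMonoidHomomorphism = record
          { isMagmaHomomorphism = record
            { isRelHomomorphism = record { cong = λ a≈b → ≈⇒≡f (∷-cong a≈b P.refl) }
            ; homo = λ a b → ≈⇒≡f (+-homo a b) }
          ; ε-homo = ≈⇒≡f 0#-homo }
        ; *-homo = λ a b → ≈⇒≡f (*-homo a b) }
      ; 1#-homo = ≈⇒≡f 1#-homo }
    ; -‿homo = λ a → ≈⇒≡f (-‿homo a) }
    where open IsRingHomomorphism constP-isRingHomomorphism

-- Subfields generated by an element of degree m.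

module GeneratedSubfield {a ℓ₁ b ℓ₂} {F : CommutativeRing a ℓ₁} {K : CommutativeRing b ℓ₂}
  {ι : CommutativeRing.Carrier F → CommutativeRing.Carrier K}
  (isHom : IsRingHomomorphism (CommutativeRing.rawRing F) (CommutativeRing.rawRing K) ι)
  (isDomain : IsDomain K) (m : ℕ)
  where
  private module F = CommutativeRing F
  open RingExtras K
  open Horner K
  open Span {F = F} {R = K} isHom
  open IsRingHomomorphism isHom using (⟦⟧-cong; 0#-homo)
  open DomainProperties isDomain

  -- β is algebraic over F of degree exactly m: the relation closes the span of the βⁱ with i < m
  -- under multiplication, and independence gives that span q^m elements.
  record Generator (β : Carrier) : Set (a Level.⊔ ℓ₁ Level.⊔ ℓ₂) where
    field
      minimal     : ℕ → F.Carrier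
      relation    : MonicRelation m β minimal
      independent : ∀ a → combination m β a ≈ 0# → ∀ i → i < m → a i F.≈ F.0#

    combination-injective : ∀ a b → combination m β a ≈ combination m β b → ∀ i → i < m → a i F.≈ b i
    combination-injective a b eq i i<m = F-≈.-≈0⇒≈ (independent (λ i → a i F.- b i) difference≈0 i i<m)
      where
      module F-≈ = RingExtras F
      open IsRingHomomorphism isHom using (+-homo; -‿homo)
      difference≈0 : combination m β (λ i → a i F.- b i) ≈ 0#
      difference≈0 = begin
        combination m β (λ i → a i F.- b i)
          ≈⟨ horner-congʳ m (λ i → trans (+-homo (a i) (F.- b i)) (+-congˡ (-‿homo (b i)))) ⟩
        horner m β (λ i → ι (a i) - ι (b i))         ≈⟨ horner-sub m β (ι ∘ a) (ι ∘ b) ⟩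
        combination m β a - combination m β b        ≈⟨ ≈⇒-≈0 eq ⟩
        0#                                           ∎

    minimal-unique : ∀ h → MonicRelation m β h → ∀ i → i < m → minimal i F.≈ h i
    minimal-unique h hβ≈0 = combination-injective minimal h
      (+-cancelʳ (β ^ m) _ _ (trans relation (sym hβ≈0)))

    generator≉0 : 0 < m → ¬ minimal 0 F.≈ F.0# → ¬ β ≈ 0#
    -- At β = 0 the relation collapses to ι(h₀) = 0. To conclude h₀ = 0, independence is applied to
    -- a sequence starting with h₀; the constant sequence serves, as its combination at 0 is ι(h₀).
    generator≉0 0<m h₀≉0 β≈0 = h₀≉0 (independent (λ _ → minimal 0) (begin
      combination m β (λ _ → minimal 0)  ≈⟨ combination-at-0 m 0<m β≈0 (λ _ → minimal 0) ⟩
      ι (minimal 0)                      ≈⟨ combination-at-0 m 0<m β≈0 minimal ⟨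
      combination m β minimal            ≈⟨ +-identityʳ _ ⟨
      combination m β minimal + 0#       ≈⟨ +-congˡ (^m≈0 m 0<m) ⟨
      combination m β minimal + β ^ m    ≈⟨ relation ⟩
      0#                                 ∎) 0 0<m)
      where
      ^m≈0 : ∀ m → 0 < m → β ^ m ≈ 0#
      ^m≈0 (suc m) _ = trans (*-congʳ β≈0) (zeroˡ _)

  module _ {q} {finite : IsFiniteField F q} {N : ℕ}
    (enumeration : Enumeration.TupleEnumeration finite m (suc N)) where
    open Enumeration.TupleEnumeration enumeration

    private
      zeroTuple : Fin (suc N)
      zeroTuple = proj₁ (tuple-surjective (λ _ → F.0#))

    module _ {β : Carrier} (generator : Generator β) where
      open Generator generator

      private
        element : Fin (suc N) → Carrier
        element k = combination m β (tuple k)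

        element-zeroTuple : element zeroTuple ≈ 0#
        element-zeroTuple = trans
          (horner-cong m refl λ i i<m → ⟦⟧-cong (proj₂ (tuple-surjective (λ _ → F.0#)) i i<m))
          (combination-0 m β)

        element-injective : ∀ {j k} → element j ≈ element k → j ≡ k
        element-injective eq = tuple-injective (combination-injective _ _ eq)

      -- `punchIn zeroTuple` skips the index of the zero tuple, and by independence that is the only
      -- index whose element is 0.
      nonzero-element : ∀ {y} → InSpan m β y → ¬ y ≈ 0# → ∃ λ j → y ≈ element (punchIn zeroTuple j)
      nonzero-element {y} (inSpan a y≈) y≉0 = punchOut k≢ , trans y≈k
          (reflexive (≡.cong element (≡.sym (Finₚ.punchIn-punchOut k≢))))
        where
        k : Fin (suc N)
        k = proj₁ (tuple-surjective a)

        y≈k : y ≈ element k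
        y≈k = trans y≈ (horner-cong m refl
          λ i i<m → ⟦⟧-cong (F.sym (proj₂ (tuple-surjective a) i i<m)))

        k≢ : zeroTuple ≢ k
        k≢ eq = y≉0 (trans y≈k (trans (reflexive (≡.cong element (≡.sym eq))) element-zeroTuple))

      nonzeroElements : FiniteSubmagma N
      nonzeroElements = record
        { elem      = element ∘ punchIn zeroTuple
        ; injective = λ eq → Finₚ.punchIn-injective zeroTuple _ _ (element-injective eq)
        ; nonzero   = nonzero
        ; closed    = λ i j → nonzero-element
            (span-* m β minimal relation (inSpan _ refl) (inSpan _ refl))
            (*-≉0 (nonzero i) (nonzero j))
        }
        where
        nonzero : ∀ j → ¬ element (punchIn zeroTuple j) ≈ 0#
        nonzero j eq = Finₚ.punchInᵢ≢i zeroTuple j (element-injective (trans eq (sym element-zeroTuple)))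

    -- The fields F(β) and F(β′) have equally many elements, hence coincide inside the domain K.
    generator∈other-span : 0 < m → ∀ {β β′} → Generator β → (γ′ : Generator β′) → ¬ β′ ≈ 0# → InSpan m β β′
    generator∈other-span 0<m {β} {β′} γ γ′ β′≉0
      with nonzero-element γ′ (generator∈span m β′ (Generator.minimal γ′) (Generator.relation γ′) 0<m) β′≉0
    ... | j , β′≈ with equipotent⇒⊆ (nonzeroElements γ) (nonzeroElements γ′) j
    ...   | k , eq = inSpan _ (trans β′≈ eq)

-- Comparing two decompositions of an irreducible polynomial.

module IrreducibleDecomposition {c ℓ} {F : CommutativeRing c ℓ} {q : ℕ} (finite : IsFiniteField F q)
  (m n : ℕ) (0<m : 0 < m)
  (f : Poly.Polynomial F) (irreducible : Poly.Irreducible F f)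
  (f-monic : CommutativeRing._≈_ F (Poly.coeff F f (m ℕ.* suc n)) (CommutativeRing.1# F))
  (f< : PolynomialProperties.Below F (suc (m ℕ.* suc n)) f)
  where
  open RingExtras F
  open IsFiniteField finite using (0≉1)
  open Poly F
  open PolynomialProperties F
  open PrincipalQuotient polynomialRing f
  open IrreducibleQuotient finite (m ℕ.* suc n) f irreducible f-monic f<
  open DomainProperties quotient-isDomain using (*-cancelˡ; *-≉0; x≉0∧xy≈0⇒y≈0)
    renaming (1≉0 to 1≢f0)
  open Horner quotientRing
  open Span {F = F} {R = quotientRing} ι-isRingHomomorphism
  open GeneratedSubfield {F = F} {K = quotientRing} ι-isRingHomomorphism quotient-isDomain m
    renaming (module Generator to SubfieldGenerator; Generator to SubfieldGenerator)
  open Enumeration finite using (tuples; nonempty)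
  private
    module P = RingExtras polynomialRing
    module K = RingExtras quotientRing

  n<mn : suc n ≤ m ℕ.* suc n
  n<mn = ℕₚ.m≤n*m (suc n) m {{ℕ.>-nonZero 0<m}}

  module Generator (g h : Polynomial) (decomposition : IsDecomposition m (suc n) f g h) where
    h_m≈1 : coeff h m ≈ 1#
    h_m≈1 = proj₁ (proj₁ decomposition)

    g< : Below (suc n) g
    g< = proj₁ (proj₂ (proj₂ decomposition))

    g₀≈1 : coeff g 0 ≈ 1#
    g₀≈1 = proj₁ (proj₂ (proj₂ (proj₂ decomposition)))

    f≋form : f ≋ form (suc n) g (suc m) (constP ∘ coeff h)
    f≋form = P.trans (coeffwise (proj₂ (proj₂ (proj₂ (proj₂ decomposition))))) (compose≋form m (suc n) g h)

    -- Since deg g < deg f, vanishing in K would mean g = 0, against g(0) = 1.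
    g≢0 : ¬ g ≡f []
    g≢0 g≡0 = 0≉1 (trans (sym (coeff-≈ (≡f0⇒≋0 g≡0 (below-mono g n<mn g<)) 0)) g₀≈1)

    β∃ : ∃ λ β → g *ₚ β ≡f X^ (suc n)
    β∃ = fromInverse (zero-or-inverse g)
      where
      fromInverse : g ≡f [] ⊎ (∃ λ u → u *ₚ g ≡f oneP) → ∃ λ β → g *ₚ β ≡f X^ (suc n)
      fromInverse (inj₁ g≡0)        = contradiction g≡0 g≢0
      fromInverse (inj₂ (u , ug≡1)) = u *ₚ X^ (suc n) , (K.begin
          g *ₚ (u *ₚ X^ (suc n))  K.≈⟨ K.*-assoc g u (X^ (suc n)) ⟨
          (g *ₚ u) *ₚ X^ (suc n)  K.≈⟨ K.*-congʳ {X^ (suc n)} (K.trans (K.*-comm g u) ug≡1) ⟩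
          oneP *ₚ X^ (suc n)      K.≈⟨ K.*-identityˡ (X^ (suc n)) ⟩
          X^ (suc n)              K.∎)

    β : Polynomial
    β = proj₁ β∃

    gβ≡X^n : g *ₚ β ≡f X^ (suc n)
    gβ≡X^n = proj₂ β∃

    -- In K the form is g^(k-1) Σ Cᵢ βⁱ. The extra factor g on the left replaces the exponent k - 1
    -- by k and keeps the identity meaningful at k = 0.
    form≡horner : ∀ k C → g *ₚ form (suc n) g k C ≡f (g ^ₚ k) *ₚ horner k β C
    form≡horner zero    C = K.trans (K.zeroʳ g) (K.sym (K.zeroʳ oneP))
    form≡horner (suc k) C = K.begin
      g *ₚ ((C 0 *ₚ (g ^ₚ k)) +ₚ (X^ (suc n) *ₚ form (suc n) g k (C ∘ suc)))
        K.≈⟨ K.solve 5 (λ g c γ x s →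
                       g K.:* ((c K.:* γ) K.:+ (x K.:* s)) K.:= (c K.:* (g K.:* γ)) K.:+ (x K.:* (g K.:* s)))
                     K.refl g (C 0) (g ^ₚ k) (X^ (suc n)) (form (suc n) g k (C ∘ suc)) ⟩
      (C 0 *ₚ (g ^ₚ suc k)) +ₚ (X^ (suc n) *ₚ (g *ₚ form (suc n) g k (C ∘ suc)))
        K.≈⟨ K.+-congˡ {C 0 *ₚ (g ^ₚ suc k)} (K.*-cong (K.sym gβ≡X^n) (form≡horner k (C ∘ suc))) ⟩
      (C 0 *ₚ (g ^ₚ suc k)) +ₚ ((g *ₚ β) *ₚ ((g ^ₚ k) *ₚ horner k β (C ∘ suc)))
        K.≈⟨ K.solve 5 (λ g c γ b s →
                       (c K.:* (g K.:* γ)) K.:+ ((g K.:* b) K.:* (γ K.:* s)) K.:= (g K.:* γ) K.:* (c K.:+ (b K.:* s)))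
                     K.refl g (C 0) (g ^ₚ k) β (horner k β (C ∘ suc)) ⟩
      (g ^ₚ suc k) *ₚ (C 0 +ₚ (β *ₚ horner k β (C ∘ suc))) K.∎

    g^≢0 : ∀ k → ¬ (g ^ₚ k) ≡f []
    g^≢0 zero    = 1≢f0
    g^≢0 (suc k) = *-≉0 {g} g≢0 (g^≢0 k)

    -- The classes of βⁱ Xʲ with i < m and j ≤ n are linearly independent over F.
    independent : ∀ C → (∀ i → Below (suc n) (C i)) → horner m β C ≡f [] → ∀ i → i < m → C i ≋ []
    independent C C< H≡0 = form-injective g< g₀≈1 m C C< (≡f0⇒≋0 form≡0 (below-form g< m C C<))
      where
      form≡0 : form (suc n) g m C ≡f []
      form≡0 = x≉0∧xy≈0⇒y≈0 g g≢0
        (K.trans (form≡horner m C) (K.trans (K.*-congˡ {g ^ₚ m} H≡0) (K.zeroʳ (g ^ₚ m))))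

    h[β]≡0 : combination (suc m) β (coeff h) ≡f []
    h[β]≡0 = x≉0∧xy≈0⇒y≈0 (g ^ₚ suc m) (g^≢0 (suc m))
      (K.trans (K.sym (form≡horner (suc m) (constP ∘ coeff h)))
        (K.trans (K.*-congˡ {g} (K.trans (≈⇒≡f (P.sym f≋form)) f≡f0)) (K.zeroʳ g)))

    generator : SubfieldGenerator β
    generator = record
      { minimal     = coeff h
      ; relation    = monicRelation m β (coeff h) h_m≈1 h[β]≡0
      ; independent = λ a a[β]≡0 i i<m → coeff-≈ (independent (constP ∘ a)
          (λ i → below-mono (constP (a i)) (s≤s z≤n) (below-constP (a i))) a[β]≡0 i i<m) 0
      }

    β≢0 : ¬ β ≡f []
    β≢0 = SubfieldGenerator.generator≉0 generator 0<m (proj₁ (proj₂ decomposition))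

  module _ (g h g′ h′ : Polynomial)
    (decomposition : IsDecomposition m (suc n) f g h) (decomposition′ : IsDecomposition m (suc n) f g′ h′)
    where
    private
      module G  = Generator g h decomposition
      module G′ = Generator g′ h′ decomposition′
      module γ = SubfieldGenerator G.generator

    β∈span : InSpan m G.β G.β
    β∈span = generator∈span m G.β (coeff h) γ.relation 0<m

    β′∈span : InSpan m G.β G′.β
    β′∈span = generator∈other-span (proj₂ (nonempty (tuples m))) 0<m G.generator G′.generator G′.β≢0

    private
      module a = InSpan β∈span
      module b = InSpan β′∈span

      -- The coefficient of βⁱ in β g - β′ g′, with both β = Σ aᵢ βⁱ and β′ = Σ bᵢ βⁱ expanded in
      -- powers below β^m. Expanding β as well treats m = 1 uniformly.
      difference : ℕ → Polynomial
      difference i = (constP (a.coordinates i) *ₚ g) +ₚ -ₚ (constP (b.coordinates i) *ₚ g′)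

      βg≡β′g′ : G.β *ₚ g ≡f G′.β *ₚ g′
      βg≡β′g′ = K.trans (K.*-comm G.β g) (K.trans G.gβ≡X^n
        (K.trans (K.sym G′.gβ≡X^n) (K.*-comm g′ G′.β)))

      difference[β]≡0 : horner m G.β difference ≡f []
      difference[β]≡0 = K.trans
        (horner-sub m G.β (λ i → constP (a.coordinates i) *ₚ g) (λ i → constP (b.coordinates i) *ₚ g′))
        (K.≈⇒-≈0 (K.trans (product a.coordinates G.β g a.eq)
          (K.trans βg≡β′g′ (K.sym (product b.coordinates G′.β g′ b.eq)))))
        where
        product : ∀ c y r → y ≡f combination m G.β c →
                  horner m G.β (λ i → constP (c i) *ₚ r) ≡f y *ₚ r
        product c y r y≡ = K.trans (horner-*ʳ m G.β r (constP ∘ c)) (K.*-congʳ {r} (K.sym y≡))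

      difference-below : ∀ i → Below (suc n) (difference i)
      difference-below i = below-+ (constP (a.coordinates i) *ₚ g) (-ₚ (constP (b.coordinates i) *ₚ g′))
        (below-* (constP (a.coordinates i)) g (below-constP _) G.g<)
        (below-neg (constP (b.coordinates i) *ₚ g′)
          (below-* (constP (b.coordinates i)) g′ (below-constP _) G′.g<))

      coordinates≈ : ∀ i → i < m → a.coordinates i ≈ b.coordinates i
      coordinates≈ i i<m = begin
        a.coordinates i                               ≈⟨ constant-term (a.coordinates i) g G.g₀≈1 ⟨
        coeff (constP (a.coordinates i) *ₚ g) 0       ≈⟨ coeff-≈ products≋ 0 ⟩
        coeff (constP (b.coordinates i) *ₚ g′) 0      ≈⟨ constant-term (b.coordinates i) g′ G′.g₀≈1 ⟩
        b.coordinates i                               ∎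
        where
        products≋ : constP (a.coordinates i) *ₚ g ≋ constP (b.coordinates i) *ₚ g′
        -- Independence holds for polynomial coefficients of degree below n, so aᵢ g = bᵢ g′ in F[X]
        -- and not merely in K; the constant terms of g and g′ are 1.
        products≋ = P.-≈0⇒≈ (G.independent difference difference-below difference[β]≡0 i i<m)

        constant-term : ∀ k r → coeff r 0 ≈ 1# → coeff (constP k *ₚ r) 0 ≈ k
        constant-term k r r₀≈1 = trans (coeff-*0 (constP k) r) (trans (*-congˡ r₀≈1) (*-identityʳ k))

    β≡β′ : G.β ≡f G′.β
    β≡β′ = K.trans a.eq (K.trans
      (horner-cong m {G.β} K.refl λ i i<m → ≈⇒≡f (∷-cong (coordinates≈ i i<m) P.refl))
      (K.sym b.eq))

    g-unique : g ≋ g′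
    g-unique = P.-≈0⇒≈ (≡f0⇒≋0 (K.≈⇒-≈0 g≡g′)
      (below-mono (g +ₚ -ₚ g′) n<mn (below-+ g (-ₚ g′) G.g< (below-neg g′ G′.g<))))
      where
      g≡g′ : g ≡f g′
      g≡g′ = *-cancelˡ G.β (K.trans βg≡β′g′ (K.*-congʳ {g′} (K.sym β≡β′))) G.β≢0

    h-unique : h ≋ h′
    h-unique = coeffwise λ i → compare i (ℕₚ.<-cmp i m)
      where
      h′[β]≡0 : combination (suc m) G.β (coeff h′) ≡f []
      -- As β = β′, the polynomial h′ also vanishes at β, and two monic relations of degree m for β
      -- must agree.
      h′[β]≡0 = K.trans (horner-cong (suc m) {a = constP ∘ coeff h′} β≡β′ (λ _ _ → K.refl)) G′.h[β]≡0

      compare : ∀ i → Tri (i < m) (i ≡ m) (m < i) → coeff h i ≈ coeff h′ i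
      compare i (tri< i<m _ _) =
        γ.minimal-unique (coeff h′) (monicRelation m G.β (coeff h′) G′.h_m≈1 h′[β]≡0) i i<m
      compare i (tri≈ _ ≡.refl _) = trans G.h_m≈1 (sym G′.h_m≈1)
      compare i (tri> _ _ m<i) =
        trans (proj₂ (proj₁ decomposition) i m<i) (sym (proj₂ (proj₁ decomposition′) i m<i))

theorem3p5 : ∀ {c ℓ : Level} (q : ℕ) → IsPrimePower q
    → (F : CommutativeRing c ℓ) → IsFiniteField F q
    → (m n : ℕ) → 0 < m → 0 < n → 1 < m ⊔ n
    → (f : Poly.Polynomial F)
    → Poly.Decomposable F m n f → Poly.Irreducible F f
    → Poly.UniquelyDecomposable F m n f
theorem3p5 q _ F finite m (suc n) 0<m _ _ f decomposable@(g , h , (h_m≈1 , _) , _ , g< , _ , f≈) irreducible =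
  decomposable , λ g h g′ h′ d d′ → coeff-≈ (g-unique g h g′ h′ d d′) , coeff-≈ (h-unique g h g′ h′ d d′)
  where
  open CommutativeRing F using (trans)
  open PolynomialProperties F
  module P = CommutativeRing polynomialRing

  form≋f : form (suc n) g (suc m) (Poly.constP F ∘ Poly.coeff F h) ≋ f
  form≋f = P.sym (P.trans (coeffwise f≈) (compose≋form m (suc n) g h))

  -- The degree and leading coefficient of f are read off the given decomposition; they then fix the
  -- quotient ring in which any two decompositions are compared.
  leading : _
  leading = form-leading g< m (Poly.coeff F h)

  open IrreducibleDecomposition finite m n 0<m f irreducible
    (trans (P.sym form≋f .coeff-≈ _) (trans (proj₁ leading) h_m≈1))
    (below-resp form≋f (proj₂ leading))
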